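{- The chromatic symmetric function $X_{C_{n,v}}$ of the cycle $C_n$ twinned at a vertex $v$ is $e$-positive. For $n\ge 5$, it satisfies the $e$-positive recurrence $$X_{C_{n,v}}=\sum_{k=3}^{n-2}(k-1)e_kX_{C_{n-k,v}}+2(n+1)(2n-3)e_{n+1}+2(n-1)(n-3)e_ne_1+e_2\bigl[X_{C_{n-2,v}}-2(n-3)e_{n-1}\bigr],$$ (in particular the bracketed term is $e$-positive), with initial conditions $X_{C_{1,v}}=2e_2$, $X_{C_{2,v}}=6e_3$, $X_{C_{3,v}}=24e_4$, and $X_{C_{4,v}}=50e_5+6e_4e_1+4e_3e_2$.
   Context: The chromatic symmetric function of a finite simple graph $H=(V,E)$ is $X_H=\sum_\kappa\prod_{u\in V}x_{\kappa(u)}$, the sum over all proper colorings $\kappa:V\to\mathbb{Z}_{>0}$. $C_n$ ($n\ge 3$) is the cycle on $n$ vertices; for the twinned graphs with small $n$, $C_1$ is taken to be a single vertex and $C_2$ a single edge, so $C_{1,v}=K_2$ and $C_{2,v}=K_3$. The twin of a graph at a vertex $v$ is obtained by adding a new vertex $v'$ joined to $v$ and to all neighbors of $v$; $C_{n,v}$ denotes $C_n$ twinned at a vertex $v$. $e_i$ is the $i$-th elementary symmetric function; a symmetric function is $e$-positive if its expansion in the basis of elementary symmetric functions has nonnegative coefficients. -}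

module Defs where

open import Data.Bool.Base using (if_then_else_)
open import Data.Empty using (⊥)
open import Data.Fin.Base using (Fin; zero; suc; toℕ)
open import Data.Fin.Properties as Fin using (all?)
open import Data.Integer.Base as ℤ using (ℤ; +_; 0ℤ; 1ℤ)
open import Data.List.Base using (List; []; _∷_; map; foldr; filter; length; upTo; allFin; cartesianProductWith)
open import Data.List.Relation.Unary.All as ListAll using ()
open import Data.List.Relation.Unary.Linked using (Linked)
open import Data.List.Relation.Unary.Unique.Propositional using (Unique)
open import Data.Nat.Base as ℕ using (ℕ; zero; suc; _∸_; _≥_; NonZero)
open import Data.Nat.Properties as ℕ using (_≤?_)
open import Data.Product.Base using (Σ-syntax; _×_; _,_; proj₂)
open import Data.Sum.Base using (_⊎_; swap)
open import Data.Vec.Base as Vec using (Vec; []; _∷_; lookup; tabulate; count)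
open import Data.Vec.Properties as Vec using ()
open import Data.Vec.Relation.Unary.All as VecAll using ()
open import Function.Base using (_∘_)
open import Level using (0ℓ)
open import Relation.Binary.Core using (Rel)
open import Relation.Binary.Definitions using (Decidable; Symmetric)
open import Relation.Binary.PropositionalEquality using (_≡_; _≢_; refl; sym)
open import Relation.Nullary.Decidable using (Dec; does; no; ¬?; _×-dec_; _⊎-dec_; _→-dec_)
open import Relation.Nullary.Negation using (¬_)

-- Formal power series over ℤ in x₁, x₂, ….
--
-- A monomial is a vector of exponents: (a₁ , … , a_N) stands for
-- x₁^a₁ ⋯ x_N^a_N.  Every monomial in the infinitely many variables is
-- of this form for all large enough N.  A series is given by its
-- coefficients, and two series are equal when all coefficients agree.

Monomial : ℕ → Set
Monomial = Vec ℕ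

Series : Set
Series = ∀ N → Monomial N → ℤ

infix 4 _≈_

_≈_ : Series → Series → Set
f ≈ g = ∀ N (α : Monomial N) → f N α ≡ g N α

-- All (β , γ) with x^β x^γ = x^α, each listed once.
factorisations : ∀ {N} → Monomial N → List (Monomial N × Monomial N)
factorisations []      = ([] , []) ∷ []
factorisations (a ∷ α) =
  cartesianProductWith (λ i (β , γ) → (i ∷ β) , ((a ∸ i) ∷ γ))
    (upTo (suc a)) (factorisations α)

sumℤ : List ℤ → ℤ
sumℤ = foldr ℤ._+_ 0ℤ

infixl 6 _+_ _-_
infixl 7 _*_
infixr 8 _·_

0# : Series
0# _ _ = 0ℤ

_+_ : Series → Series → Series
(f + g) N α = f N α ℤ.+ g N α

_-_ : Series → Series → Series
(f - g) N α = f N α ℤ.- g N α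

_*_ : Series → Series → Series
(f * g) N α = sumℤ (map (λ (β , γ) → f N β ℤ.* g N γ) (factorisations α))

_·_ : ℤ → Series → Series
(c · f) N α = c ℤ.* f N α

-- ∑[ a ⋯ b ] f = f a + f (a + 1) + ⋯ + f b, which is 0# when b < a.
∑[_⋯_] : ℕ → ℕ → (ℕ → Series) → Series
∑[ a ⋯ b ] f N α = sumℤ (map (λ i → f (a ℕ.+ i) N α) (upTo (suc b ∸ a)))

-- e k is the sum of all squarefree monomials of degree k; e 0 = 1.
e : ℕ → Series
e k _ α = if does (VecAll.all? (_≤? 1) α ×-dec (Vec.sum α ℕ.≟ k)) then 1ℤ else 0ℤ

record Partition : Set where
  field
    parts      : List ℕ
    positive   : ListAll.All NonZero parts
    decreasing : Linked _≥_ parts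

open Partition public

eProduct : List ℕ → Series
eProduct []       = e 0
eProduct (k ∷ ks) = e k * eProduct ks

e[_] : Partition → Series
e[ p ] = eProduct (parts p)

-- A finite ℤ-linear combination of pairwise distinct basis elements e_λ
-- equal to f.
record EExpansion (f : Series) : Set where
  field
    terms    : List (ℤ × Partition)
    distinct : Unique (map (parts ∘ proj₂) terms)
    expands  : f ≈ λ N α → sumℤ (map (λ (c , p) → c ℤ.* e[ p ] N α) terms)

open EExpansion public

EPositive : Series → Set
EPositive f = Σ[ E ∈ EExpansion f ] ListAll.All (λ (c , _) → 0ℤ ℤ.≤ c) (terms E)

record Graph (n : ℕ) : Set₁ where
  field
    Adj       : Rel (Fin n) 0ℓ
    adj?      : Decidable Adj
    symmetric : Symmetric Adj
    loopless  : ∀ u → ¬ Adj u u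

open Graph public

Next : ∀ {n} → Rel (Fin n) 0ℓ
Next {n} u w = (toℕ w ≡ suc (toℕ u)) ⊎ (suc (toℕ u) ≡ n × toℕ w ≡ 0)

next? : ∀ {n} → Decidable (Next {n})
next? {n} u w =
  (toℕ w ℕ.≟ suc (toℕ u)) ⊎-dec ((suc (toℕ u) ℕ.≟ n) ×-dec (toℕ w ℕ.≟ 0))

-- The condition u ≢ w only matters for n = 1; thus C₁ is a single
-- vertex and C₂ a single edge.
cycle : ∀ n → Graph n
cycle n = record
  { Adj       = λ u w → u ≢ w × (Next u w ⊎ Next w u)
  ; adj?      = λ u w → ¬? (u Fin.≟ w) ×-dec (next? u w ⊎-dec next? w u)
  ; symmetric = λ (u≢w , n) → (u≢w ∘ sym) , swap n
  ; loopless  = λ u (u≢u , _) → u≢u refl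
  }

module _ {n} (G : Graph n) (v : Fin n) where

  -- zero is the new vertex v′, and suc u is the old vertex u.
  TwinAdj : Rel (Fin (suc n)) 0ℓ
  TwinAdj zero    zero    = ⊥
  TwinAdj zero    (suc w) = w ≡ v ⊎ Adj G v w
  TwinAdj (suc u) zero    = u ≡ v ⊎ Adj G v u
  TwinAdj (suc u) (suc w) = Adj G u w

  twinAdj? : Decidable TwinAdj
  twinAdj? zero    zero    = no λ ()
  twinAdj? zero    (suc w) = (w Fin.≟ v) ⊎-dec adj? G v w
  twinAdj? (suc u) zero    = (u Fin.≟ v) ⊎-dec adj? G v u
  twinAdj? (suc u) (suc w) = adj? G u w

  twinSym : Symmetric TwinAdj
  twinSym {zero}  {suc w} a = a
  twinSym {suc u} {zero}  a = a
  twinSym {suc u} {suc w} a = symmetric G a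

  twinLoopless : ∀ u → ¬ TwinAdj u u
  twinLoopless (suc u) a = loopless G u a

  twin : Graph (suc n)
  twin = record
    { Adj       = TwinAdj
    ; adj?      = twinAdj?
    ; symmetric = λ {u} {w} → twinSym {u} {w}
    ; loopless  = twinLoopless
    }

Colouring : ℕ → ℕ → Set
Colouring n N = Vec (Fin N) n

Proper : ∀ {n N} → Graph n → Colouring n N → Set
Proper G κ = ∀ u w → Adj G u w → lookup κ u ≢ lookup κ w

proper? : ∀ {n N} (G : Graph n) (κ : Colouring n N) → Dec (Proper G κ)
proper? G κ =
  all? λ u → all? λ w → adj? G u w →-dec ¬? (lookup κ u Fin.≟ lookup κ w)

colourings : ∀ n N → List (Colouring n N)
colourings zero    N = [] ∷ []
colourings (suc n) N = cartesianProductWith _∷_ (allFin N) (colourings n N)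

-- The product of x_κ(u) over all vertices u.
weight : ∀ {n N} → Colouring n N → Monomial N
weight κ = tabulate λ i → count (i Fin.≟_) κ

-- The coefficient of x^α in X_G is the number of proper colourings of
-- weight x^α.  A colouring by positive integers whose weight is
-- x₁^a₁ ⋯ x_N^a_N uses only the first N colours, so it suffices to
-- enumerate the colourings with colours in Fin N.
X : ∀ {n} → Graph n → Series
X {n} G N α =
  + length (filter (λ κ → proper? G κ ×-dec Vec.≡-dec ℕ._≟_ (weight κ) α) (colourings n N))

-- A choice of a vertex in each of the cycles C₁, C₂, ….
CycleVertices : Set
CycleVertices = ∀ n → .{{NonZero n}} → Fin n

-- The chromatic symmetric function of C_n twinned at v n.  There is no
-- C₀; its value is a placeholder.
XC : CycleVertices → ℕ → Series
XC v zero      = 0#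
XC v n@(suc _) = X (twin (cycle n) (v n))

{-# OPTIONS --safe #-}
-- In ℤ[[x]][[z]] put X_c = x_c z, y_c = X_c / (1 + X_c), E = ∏ (1 + X_c) = Σ e_k z^k,
-- and let p, p₂ be the sums of the y_c and of their squares.
-- A proper colouring of the twinned cycle is a pair of distinct colours a, b of v′, v
-- followed by a word without equal adjacent letters whose first and last letters avoid
-- a and b.  The transfer equations for such words are G_c = X_c (t_c + Σ_d G_d - G_c),
-- where t_c is 1 if c ∉ {a, b} and 0 otherwise, i.e. G_c = y_c (t_c + Σ_d G_d); summing
-- over c, the generating function Q of all admissible words satisfies
-- (1 - p) Q = s (1 - p + s) with s = p - y_a - y_b.
-- Multiplying by X_a X_b, summing over a ≠ b and using X y = X - y leaves a polynomial in
-- ΣX, ΣX², p and p² - p₂.  Multiplied by E it becomes explicit, because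
-- E p = Σ k e_k z^k and E (p² - p₂) = Σ k (k-1) e_k z^k, while
-- E (1 - p) = Σ (1-k) e_k z^k is the recurrence operator.  Comparing coefficients gives
-- both the recurrence and the initial values.
-- For e-positivity the induction carries X_{C_n,v} - 2(n-1) e_{n+1} along, as the bracket
-- in the recurrence has this form.

module Submission where

open import Algebra.Bundles using (CommutativeRing)
import Algebra.Properties.AbelianGroup as AbelianGroupProperties
import Algebra.Properties.CommutativeSemigroup as CommutativeSemigroupProperties
import Algebra.Properties.Ring as RingProperties
import Algebra.Properties.Semiring.Sum as SemiringSum
import Algebra.Solver.Ring as RingSolver
open import Algebra.Solver.Ring.AlmostCommutativeRing using (fromCommutativeRing; _-Raw-AlmostCommutative⟶_)
open import Data.Bool.Base using (Bool; true; false; if_then_else_; _∧_)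
open import Data.Fin.Base using (Fin; zero; suc; toℕ; fromℕ; inject₁)
open import Data.Fin.Properties as Fin using ()
open import Data.Fin.Relation.Unary.Top using (‵fromℕ; ‵inj₁; view; view-fromℕ; view-inject₁)
open import Data.Integer.Base as ℤ using (ℤ; +_; -[1+_]; 0ℤ)
open import Data.Integer.Properties as ℤ using ()
import Data.Integer.Solver as ℤ
open import Data.List.Base as List using (List; []; _∷_; map; filter; length; upTo; applyUpTo; allFin; cartesianProductWith; _++_)
import Data.List.Properties as List
open import Data.List.Relation.Binary.Permutation.Propositional as ↭ using (_↭_; ↭-sym)
open import Data.List.Relation.Binary.Permutation.Propositional.Properties using (All-resp-↭)
open import Data.List.Relation.Unary.All using (All; []; _∷_)
open import Data.List.Relation.Unary.AllPairs using ([]; _∷_)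
open import Data.List.Relation.Unary.Unique.Propositional using (Unique)
open import Data.List.Sort using (sort; sort-↭; sort-↗)
open import Data.Maybe.Base using (Maybe; just; nothing)
open import Data.Nat.Base as ℕ using (ℕ; zero; suc; _∸_; _≤_; NonZero)
open import Data.Nat.Induction using (<-rec)
open import Data.Nat.Properties as ℕ using ()
import Data.Nat.Solver as ℕ
open import Data.Product.Base as Product using (_×_; _,_; proj₁; proj₂; ∃)
open import Data.Sum.Base as Sum using (_⊎_; inj₁; inj₂)
open import Data.Vec.Base as Vec using (Vec; []; _∷_; _∷ʳ_; lookup; tabulate)
open import Data.Vec.Properties as Vec using ()
open import Data.Vec.Relation.Unary.All as VecAll using ()
open import Function.Base using (_∘_; id; _$_)
open import Level using (0ℓ)
open import Relation.Binary.Construct.Flip.EqAndOrd using (decTotalOrder)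
open import Relation.Binary.PropositionalEquality as ≡ using (_≡_; _≢_)
import Relation.Binary.Reasoning.Setoid as SetoidReasoning
open import Relation.Nullary.Decidable using (Dec; does; yes; no; ¬?; _×-dec_)
open import Relation.Nullary.Negation using (contradiction)
import Defs
open Defs using (Graph; Adj; Next; cycle; twin; Proper; proper?; Monomial; sumℤ; factorisations; e; colourings; weight; Colouring; CycleVertices; XC)

-- No series is ever inverted. Equations such as `y + X y = X` are used as relations: an identity
-- that holds only modulo them becomes a polynomial identity with explicit cofactors, which a ring
-- solver with integer coefficients checks. Likewise the equation for (1 - p) F, with F the
-- generating function of all the twinned cycles, is solved only after multiplication by E, because
-- E (1 - p) has the coefficients 1, 0, -e₂, -2e₃, .... The leading 1 isolates the newest term, the
-- 0 explains why no e₁ multiplies an earlier chromatic series, and -e₂ supplies the e₂ X_(n-2) that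
-- absorbs the only negative term, -2(n-3) e₂ e_(n-1), in the bracket. The series of the statement
-- are bare coefficient functions on exponent vectors, with a product given by a list of
-- factorisations. The argument therefore runs over an arbitrary commutative ring with N chosen
-- elements, and the statement is reached by specialising to the N-fold iterated power series ring
-- over ℤ. Since the twinned vertex is an arbitrary choice for every n, rotation invariance has to
-- be shown as well.

module Integers {c ℓ} (R : CommutativeRing c ℓ) where
  open CommutativeRing R hiding (zero)
  open RingProperties ring using (-‿distribˡ-*)
  open AbelianGroupProperties +-abelianGroup using (⁻¹-involutive; ε⁻¹≈ε; ⁻¹-∙-comm)
  open SetoidReasoning setoid

  -- The clause for 1 makes the solver's constant 1 the unit 1# definitionally.
  natural : ℕ → Carrier
  natural zero          = 0#
  natural (suc zero)    = 1#
  natural (suc (suc n)) = 1# + natural (suc n)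

  natural-suc : ∀ n → natural (suc n) ≈ 1# + natural n
  natural-suc zero    = sym (+-identityʳ 1#)
  natural-suc (suc n) = refl

  -- The canonical map from ℤ. It is the coefficient map of the ring solver: equality of integers is
  -- decidable, equality in an arbitrary ring need not be.
  ι : ℤ → Carrier
  ι (+ n)    = natural n
  ι -[1+ n ] = - natural (suc n)

  ι-cong : ∀ {i j} → i ≡ j → ι i ≈ ι j
  ι-cong ≡.refl = refl

  ι-neg : ∀ i → ι (ℤ.- i) ≈ - ι i
  ι-neg (+ zero)    = sym ε⁻¹≈ε
  ι-neg (+ (suc n)) = refl
  ι-neg -[1+ n ]    = sym (⁻¹-involutive _)

  ι-suc : ∀ i → ι (ℤ.suc i) ≈ 1# + ι i
  ι-suc (+ n)        = natural-suc n
  ι-suc -[1+ zero ]  = sym (-‿inverseʳ 1#)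
  ι-suc -[1+ suc n ] = begin
    - natural (suc n)                  ≈⟨ +-identityˡ _ ⟨
    0# + - natural (suc n)             ≈⟨ +-congʳ (-‿inverseʳ 1#) ⟨
    (1# + - 1#) + - natural (suc n)    ≈⟨ +-assoc _ _ _ ⟩
    1# + (- 1# + - natural (suc n))    ≈⟨ +-congˡ (⁻¹-∙-comm _ _) ⟩
    1# + - (1# + natural (suc n))      ∎

  private
    ι-+₊ : ∀ m j → ι (+ m ℤ.+ j) ≈ ι (+ m) + ι j
    ι-+₊ zero    j = trans (ι-cong (ℤ.+-identityˡ j)) (sym (+-identityˡ _))
    ι-+₊ (suc m) j = begin
      ι (+ (suc m) ℤ.+ j)      ≈⟨ ι-cong (ℤ.suc-+ m j) ⟩
      ι (ℤ.suc (+ m ℤ.+ j))    ≈⟨ ι-suc (+ m ℤ.+ j) ⟩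
      1# + ι (+ m ℤ.+ j)       ≈⟨ +-congˡ (ι-+₊ m j) ⟩
      1# + (ι (+ m) + ι j)     ≈⟨ +-assoc _ _ _ ⟨
      (1# + ι (+ m)) + ι j     ≈⟨ +-congʳ (natural-suc m) ⟨
      ι (+ (suc m)) + ι j      ∎

  ι-+ : ∀ i j → ι (i ℤ.+ j) ≈ ι i + ι j
  ι-+ (+ m)    j = ι-+₊ m j
  ι-+ -[1+ m ] j = begin
    ι (-[1+ m ] ℤ.+ j)                 ≈⟨ ι-cong (≡.cong (λ k → -[1+ m ] ℤ.+ k) (ℤ.neg-involutive j)) ⟨
    ι (-[1+ m ] ℤ.+ ℤ.- (ℤ.- j))       ≈⟨ ι-cong (ℤ.neg-distrib-+ (+ (suc m)) (ℤ.- j)) ⟨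
    ι (ℤ.- (+ (suc m) ℤ.+ ℤ.- j))      ≈⟨ ι-neg (+ (suc m) ℤ.+ ℤ.- j) ⟩
    - ι (+ (suc m) ℤ.+ ℤ.- j)          ≈⟨ -‿cong (ι-+₊ (suc m) (ℤ.- j)) ⟩
    - (ι (+ (suc m)) + ι (ℤ.- j))      ≈⟨ ⁻¹-∙-comm _ _ ⟨
    - ι (+ (suc m)) + - ι (ℤ.- j)      ≈⟨ +-congˡ (ι-neg (ℤ.- j)) ⟨
    ι -[1+ m ] + ι (ℤ.- (ℤ.- j))       ≈⟨ +-congˡ (ι-cong (ℤ.neg-involutive j)) ⟩
    ι -[1+ m ] + ι j                   ∎

  private
    ι-*₊ : ∀ m j → ι (+ m ℤ.* j) ≈ ι (+ m) * ι j
    ι-*₊ zero    j = sym (zeroˡ _)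
    ι-*₊ (suc m) j = begin
      ι (+ (suc m) ℤ.* j)          ≈⟨ ι-cong (ℤ.suc-* (+ m) j) ⟩
      ι (j ℤ.+ + m ℤ.* j)          ≈⟨ ι-+ j (+ m ℤ.* j) ⟩
      ι j + ι (+ m ℤ.* j)          ≈⟨ +-cong (sym (*-identityˡ _)) (ι-*₊ m j) ⟩
      1# * ι j + ι (+ m) * ι j     ≈⟨ distribʳ _ _ _ ⟨
      (1# + ι (+ m)) * ι j         ≈⟨ *-congʳ (natural-suc m) ⟨
      ι (+ (suc m)) * ι j          ∎

  ι-* : ∀ i j → ι (i ℤ.* j) ≈ ι i * ι j
  ι-* (+ m)    j = ι-*₊ m j
  ι-* -[1+ m ] j = begin
    ι (-[1+ m ] ℤ.* j)            ≈⟨ ι-cong (ℤ.neg-distribˡ-* (+ (suc m)) j) ⟨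
    ι (ℤ.- (+ (suc m) ℤ.* j))     ≈⟨ ι-neg (+ (suc m) ℤ.* j) ⟩
    - ι (+ (suc m) ℤ.* j)         ≈⟨ -‿cong (ι-*₊ (suc m) j) ⟩
    - (ι (+ (suc m)) * ι j)       ≈⟨ -‿distribˡ-* _ _ ⟩
    ι -[1+ m ] * ι j              ∎

  ι-morphism : CommutativeRing.rawRing ℤ.+-*-commutativeRing -Raw-AlmostCommutative⟶ fromCommutativeRing R
  ι-morphism = record
    { ⟦_⟧    = ι
    ; +-homo = ι-+
    ; *-homo = ι-*
    ; -‿homo = ι-neg
    ; 0-homo = refl
    ; 1-homo = refl
    }

  private
    ι-≟ : ∀ i j → Maybe (ι i ≈ ι j)
    ι-≟ i j with i ℤ.≟ j
    ... | yes i≡j = just (ι-cong i≡j)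
    ... | no  _   = nothing

  module Solver = RingSolver (CommutativeRing.rawRing ℤ.+-*-commutativeRing) (fromCommutativeRing R) ι-morphism ι-≟

-- Formal power series over a commutative ring

module PowerSeries {c ℓ} (R : CommutativeRing c ℓ) where
  open CommutativeRing R hiding (zero)
  open CommutativeSemigroupProperties +-commutativeSemigroup using (interchange)
  open AbelianGroupProperties +-abelianGroup using (ε⁻¹≈ε)
  open SetoidReasoning setoid

  infixl 7 _⊛_
  infix  4 _≐_

  _≐_ : (ℕ → Carrier) → (ℕ → Carrier) → Set ℓ
  f ≐ g = ∀ n → f n ≈ g n

  tail : (ℕ → Carrier) → ℕ → Carrier
  tail f = f ∘ suc

  -- Peeling off f 0 avoids the indices n ∸ i, so that the ring laws follow by
  -- induction on the degree.
  _⊛_ : (ℕ → Carrier) → (ℕ → Carrier) → ℕ → Carrier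
  (f ⊛ g) zero    = f 0 * g 0
  (f ⊛ g) (suc n) = f 0 * g (suc n) + (tail f ⊛ g) n

  const : Carrier → ℕ → Carrier
  const r zero    = r
  const r (suc _) = 0#

  shift : (ℕ → Carrier) → ℕ → Carrier
  shift f zero    = 0#
  shift f (suc n) = f n

  ⊛-cong : ∀ {f f′ g g′} → f ≐ f′ → g ≐ g′ → f ⊛ g ≐ f′ ⊛ g′
  ⊛-cong p q zero    = *-cong (p 0) (q 0)
  ⊛-cong p q (suc n) = +-cong (*-cong (p 0) (q (suc n))) (⊛-cong (p ∘ suc) q n)

  -- The definition peels the left factor only. Peeling the right factor as well is what makes
  -- commutativity an induction on the degree.
  ⊛-last : ∀ f g n → (f ⊛ g) (suc n) ≈ (f ⊛ tail g) n + f (suc n) * g 0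
  ⊛-last f g zero    = refl
  ⊛-last f g (suc n) = begin
    f 0 * g (2 ℕ.+ n) + (tail f ⊛ g) (suc n)
      ≈⟨ +-congˡ (⊛-last (tail f) g n) ⟩
    f 0 * g (2 ℕ.+ n) + ((tail f ⊛ tail g) n + f (2 ℕ.+ n) * g 0)
      ≈⟨ +-assoc _ _ _ ⟨
    (f ⊛ tail g) (suc n) + f (2 ℕ.+ n) * g 0
      ∎

  ⊛-comm : ∀ f g → f ⊛ g ≐ g ⊛ f
  ⊛-comm f g zero    = *-comm _ _
  ⊛-comm f g (suc n) = begin
    f 0 * g (suc n) + (tail f ⊛ g) n    ≈⟨ +-cong (*-comm _ _) (⊛-comm (tail f) g n) ⟩
    g (suc n) * f 0 + (g ⊛ tail f) n    ≈⟨ +-comm _ _ ⟩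
    (g ⊛ tail f) n + g (suc n) * f 0    ≈⟨ ⊛-last g f n ⟨
    (g ⊛ f) (suc n)                     ∎

  ⊛-distribˡ : ∀ f g h → f ⊛ (λ n → g n + h n) ≐ (λ n → (f ⊛ g) n + (f ⊛ h) n)
  ⊛-distribˡ f g h zero    = distribˡ _ _ _
  ⊛-distribˡ f g h (suc n) =
    trans (+-cong (distribˡ _ _ _) (⊛-distribˡ (tail f) g h n)) (interchange _ _ _ _)

  ⊛-distribʳ : ∀ f g h → (λ n → g n + h n) ⊛ f ≐ (λ n → (g ⊛ f) n + (h ⊛ f) n)
  ⊛-distribʳ f g h zero    = distribʳ _ _ _
  ⊛-distribʳ f g h (suc n) =
    trans (+-cong (distribʳ _ _ _) (⊛-distribʳ f (tail g) (tail h) n)) (interchange _ _ _ _)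

  ⊛-scaleˡ : ∀ r f g → (λ n → r * f n) ⊛ g ≐ (λ n → r * (f ⊛ g) n)
  ⊛-scaleˡ r f g zero    = *-assoc _ _ _
  ⊛-scaleˡ r f g (suc n) =
    trans (+-cong (*-assoc _ _ _) (⊛-scaleˡ r (tail f) g n)) (sym (distribˡ _ _ _))

  ⊛-assoc : ∀ f g h → (f ⊛ g) ⊛ h ≐ f ⊛ (g ⊛ h)
  ⊛-assoc f g h zero    = *-assoc _ _ _
  ⊛-assoc f g h (suc n) = begin
    f 0 * g 0 * h (suc n) + (tail (f ⊛ g) ⊛ h) n
      -- By definition the tail of `f ⊛ g` is `f 0` times the tail of `g`, plus `tail f ⊛ g`.
      ≈⟨ +-cong (*-assoc _ _ _) (⊛-distribʳ h (λ i → f 0 * g (suc i)) (tail f ⊛ g) n) ⟩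
    f 0 * (g 0 * h (suc n)) + (((λ i → f 0 * g (suc i)) ⊛ h) n + ((tail f ⊛ g) ⊛ h) n)
      ≈⟨ +-congˡ (+-cong (⊛-scaleˡ (f 0) (tail g) h n) (⊛-assoc (tail f) g h n)) ⟩
    f 0 * (g 0 * h (suc n)) + (f 0 * (tail g ⊛ h) n + (tail f ⊛ (g ⊛ h)) n)
      ≈⟨ +-assoc _ _ _ ⟨
    f 0 * (g 0 * h (suc n)) + f 0 * (tail g ⊛ h) n + (tail f ⊛ (g ⊛ h)) n
      ≈⟨ +-congʳ (distribˡ _ _ _) ⟨
    (f ⊛ (g ⊛ h)) (suc n)
      ∎

  ⊛-zeroˡ : ∀ {f} g → f ≐ (λ _ → 0#) → f ⊛ g ≐ (λ _ → 0#)
  ⊛-zeroˡ g z zero    = trans (*-congʳ (z 0)) (zeroˡ _)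
  ⊛-zeroˡ g z (suc n) =
    trans (+-cong (trans (*-congʳ (z 0)) (zeroˡ _)) (⊛-zeroˡ g (z ∘ suc) n)) (+-identityˡ _)

  const-⊛ : ∀ r f → const r ⊛ f ≐ (λ n → r * f n)
  const-⊛ r f zero    = refl
  const-⊛ r f (suc n) = trans (+-congˡ (⊛-zeroˡ f (λ _ → refl) n)) (+-identityʳ _)

  shift-⊛ : ∀ f g → shift f ⊛ g ≐ shift (f ⊛ g)
  shift-⊛ f g zero    = zeroˡ _
  shift-⊛ f g (suc n) = trans (+-congʳ (zeroˡ _)) (+-identityˡ _)

  shift-const-⊛ : ∀ r f → shift (const r) ⊛ f ≐ shift (λ n → r * f n)
  shift-const-⊛ r f zero    = shift-⊛ (const r) f zero
  shift-const-⊛ r f (suc n) = trans (shift-⊛ (const r) f (suc n)) (const-⊛ r f n)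

  R[[z]] : CommutativeRing c ℓ
  R[[z]] = record
    { Carrier = ℕ → Carrier
    ; _≈_     = _≐_
    ; _+_     = λ f g n → f n + g n
    ; _*_     = _⊛_
    ; -_      = λ f n → - f n
    ; 0#      = λ _ → 0#
    ; 1#      = const 1#
    ; isCommutativeRing = record
      { isRing = record
        { +-isAbelianGroup = record
          { isGroup = record
            { isMonoid = record
              { isSemigroup = record
                { isMagma = record
                  { isEquivalence = record
                    { refl  = λ _ → refl
                    ; sym   = λ p n → sym (p n)
                    ; trans = λ p q n → trans (p n) (q n)
                    }
                  ; ∙-cong = λ p q n → +-cong (p n) (q n)
                  }
                ; assoc = λ f g h n → +-assoc (f n) (g n) (h n)
                }
              ; identity = (λ f n → +-identityˡ (f n)) , (λ f n → +-identityʳ (f n))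
              }
            ; inverse = (λ f n → -‿inverseˡ (f n)) , (λ f n → -‿inverseʳ (f n))
            ; ⁻¹-cong = λ p n → -‿cong (p n)
            }
          ; comm = λ f g n → +-comm (f n) (g n)
          }
        ; *-cong     = ⊛-cong
        ; *-assoc    = ⊛-assoc
        ; *-identity = 1⊛ , (λ f n → trans (⊛-comm f (const 1#) n) (1⊛ f n))
        ; distrib    = ⊛-distribˡ , ⊛-distribʳ
        }
      ; *-comm = ⊛-comm
      }
    }
    where
    1⊛ : ∀ f → const 1# ⊛ f ≐ f
    1⊛ f n = trans (const-⊛ 1# f n) (*-identityˡ _)

  private
    module S  = CommutativeRing R[[z]]
    module ιR = Integers R
    module ιS = Integers R[[z]]
    module ∑R = SemiringSum semiring
    module ∑S = SemiringSum S.semiring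

  sum-coefficient : ∀ {n} (f : Fin n → ℕ → Carrier) k → ∑S.sum f k ≈ ∑R.sum (λ i → f i k)
  sum-coefficient {zero}  f k = refl
  sum-coefficient {suc n} f k = +-congˡ (sum-coefficient (f ∘ suc) k)

  private
    ι-coefficient₊ : ∀ n → ιS.ι (+ n) ≐ const (ιR.ι (+ n))
    ι-coefficient₊ zero          zero    = refl
    ι-coefficient₊ zero          (suc k) = refl
    ι-coefficient₊ (suc zero)    zero    = refl
    ι-coefficient₊ (suc zero)    (suc k) = refl
    ι-coefficient₊ (suc (suc n)) zero    = +-congˡ (ι-coefficient₊ (suc n) zero)
    ι-coefficient₊ (suc (suc n)) (suc k) = trans (+-identityˡ _) (ι-coefficient₊ (suc n) (suc k))

  -- Integer constants of the series ring are constant series, so that solver constants can be read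
  -- off coefficient by coefficient.
  ι-coefficient : ∀ i → ιS.ι i ≐ const (ιR.ι i)
  ι-coefficient (+ n)    k       = ι-coefficient₊ n k
  ι-coefficient -[1+ n ] zero    = -‿cong (ι-coefficient₊ (suc n) zero)
  ι-coefficient -[1+ n ] (suc k) = trans (-‿cong (ι-coefficient₊ (suc n) (suc k))) ε⁻¹≈ε

  ι-⊛ : ∀ i f → ιS.ι i ⊛ f ≐ (λ n → ιR.ι i * f n)
  ι-⊛ i f n = trans (⊛-cong (ι-coefficient i) (λ _ → refl) n) (const-⊛ (ιR.ι i) f n)

-- Finite sums and indicators in a commutative ring

module Sums {c ℓ} (A : CommutativeRing c ℓ) where
  open CommutativeRing A hiding (zero)
  open AbelianGroupProperties +-abelianGroup using (ε⁻¹≈ε; ⁻¹-∙-comm)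
  open SetoidReasoning setoid
  open SemiringSum semiring public
    using (sum; ∑-distrib-+; ∑-comm; *-distribˡ-sum; *-distribʳ-sum; sum-cong-≋)

  ind : ∀ {p} {P : Set p} → Dec P → Carrier
  ind d = if does d then 1# else 0#

  -- Rewriting modulo the relation `u ≈ v`: `r` is the cofactor, and the second hypothesis is then a
  -- polynomial identity within reach of the ring solver.
  modulo : ∀ {u v x y} r → u ≈ v → x ≈ y + r * (u - v) → x ≈ y
  modulo {u} {v} {x} {y} r u≈v x≈y+ = begin
    x                  ≈⟨ x≈y+ ⟩
    y + r * (u - v)    ≈⟨ +-congˡ (*-congˡ (+-congʳ u≈v)) ⟩
    y + r * (v - v)    ≈⟨ +-congˡ (*-congˡ (-‿inverseʳ v)) ⟩
    y + r * 0#         ≈⟨ +-congˡ (zeroʳ r) ⟩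
    y + 0#             ≈⟨ +-identityʳ y ⟩
    y                  ∎

  sum-neg : ∀ {n} (f : Fin n → Carrier) → sum (λ i → - f i) ≈ - sum f
  sum-neg {zero}  f = sym ε⁻¹≈ε
  sum-neg {suc n} f = trans (+-congˡ (sum-neg (f ∘ suc))) (⁻¹-∙-comm _ _)

  sum-sub : ∀ {n} (f g : Fin n → Carrier) → sum (λ i → f i - g i) ≈ sum f - sum g
  sum-sub f g = trans (∑-distrib-+ f (λ i → - g i)) (+-congˡ (sum-neg g))

  sum-scale : ∀ {n} r (f : Fin n → Carrier) → sum (λ i → r * f i) ≈ r * sum f
  sum-scale r f = sym (*-distribˡ-sum r f)

  sum-product : ∀ {m n} (f : Fin m → Carrier) (g : Fin n → Carrier) →
                sum (λ i → sum (λ j → f i * g j)) ≈ sum f * sum g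
  sum-product f g =
    trans (sum-cong-≋ (λ i → sum-scale (f i) g)) (sym (*-distribʳ-sum (sum g) f))

  sum-zero : ∀ {n} {f : Fin n → Carrier} → (∀ i → f i ≈ 0#) → sum f ≈ 0#
  sum-zero {zero}  z = refl
  sum-zero {suc n} z = trans (+-cong (z zero) (sum-zero (z ∘ suc))) (+-identityˡ _)

  sum-δ : ∀ {n} (i : Fin n) (f : Fin n → Carrier) → sum (λ j → ind (i Fin.≟ j) * f j) ≈ f i
  sum-δ zero    f = begin
    1# * f zero + sum (λ j → 0# * f (suc j))   ≈⟨ +-cong (*-identityˡ _) (sum-zero (λ j → zeroˡ (f (suc j)))) ⟩
    f zero + 0#                                ≈⟨ +-identityʳ _ ⟩
    f zero                                     ∎
  sum-δ (suc i) f = begin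
    0# * f zero + sum (λ j → ind (i Fin.≟ j) * f (suc j))   ≈⟨ +-cong (zeroˡ _) (sum-δ i (f ∘ suc)) ⟩
    0# + f (suc i)                                          ≈⟨ +-identityˡ _ ⟩
    f (suc i)                                               ∎

  ind-¬ : ∀ {p} {P : Set p} (d : Dec P) → ind (¬? d) ≈ 1# - ind d
  ind-¬ (yes _) = sym (-‿inverseʳ 1#)
  ind-¬ (no _)  = sym (trans (+-congˡ ε⁻¹≈ε) (+-identityʳ 1#))

  ind-× : ∀ {p q} {P : Set p} {Q : Set q} (d : Dec P) (d′ : Dec Q) → ind (d ×-dec d′) ≈ ind d * ind d′
  ind-× (yes _) d′ = sym (*-identityˡ _)
  ind-× (no _)  d′ = sym (zeroˡ _)

  ind-cong : ∀ {p q} {P : Set p} {Q : Set q} (d : Dec P) (d′ : Dec Q) → (P → Q) → (Q → P) → ind d ≈ ind d′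
  ind-cong (yes _) (yes _) f g = refl
  ind-cong (yes p) (no ¬q) f g = contradiction (f p) ¬q
  ind-cong (no ¬p) (yes q) f g = contradiction (g q) ¬p
  ind-cong (no _)  (no _)  f g = refl

  -- Makes a condition such as `a ≢ b` available to the terms that its own indicator multiplies.
  ind-guard : ∀ {p} {P : Set p} (d : Dec P) {x y} → (P → x ≈ y) → ind d * x ≈ ind d * y
  ind-guard (yes p) x≈y = *-congˡ (x≈y p)
  ind-guard (no _)  x≈y = trans (zeroˡ _) (sym (zeroˡ _))

  sum-≢ : ∀ {n} (i : Fin n) (f : Fin n → Carrier) → sum (λ j → ind (¬? (i Fin.≟ j)) * f j) ≈ sum f - f i
  sum-≢ i f = begin
    sum (λ j → ind (¬? (i Fin.≟ j)) * f j)
      ≈⟨ sum-cong-≋ (λ j → trans (*-congʳ (ind-¬ (i Fin.≟ j))) (expand (ind (i Fin.≟ j)) (f j))) ⟩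
    sum (λ j → f j - ind (i Fin.≟ j) * f j)
      ≈⟨ sum-sub f (λ j → ind (i Fin.≟ j) * f j) ⟩
    sum f - sum (λ j → ind (i Fin.≟ j) * f j)
      ≈⟨ +-congˡ (-‿cong (sum-δ i f)) ⟩
    sum f - f i
      ∎
    where
    open Integers.Solver A using (solve; con; _:*_; _:-_; _:=_)
    expand : ∀ x y → (1# - x) * y ≈ y - x * y
    expand x y = solve 2 (λ x y → (con (+ 1) :- x) :* y := y :- x :* y) refl x y

  sum-off-diagonal : ∀ {n} (f : Fin n → Fin n → Carrier) →
    sum (λ i → sum (λ j → ind (¬? (i Fin.≟ j)) * f i j)) ≈
    sum (λ i → sum (λ j → f i j)) - sum (λ i → f i i)
  sum-off-diagonal f =
    trans (sum-cong-≋ (λ i → sum-≢ i (f i))) (sum-sub (λ i → sum (f i)) (λ i → f i i))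

  sumV : ∀ {N} n → (Vec (Fin N) n → Carrier) → Carrier
  sumV zero    f = f []
  sumV (suc n) f = sum (λ i → sumV n (λ w → f (i ∷ w)))

  sumV-cong : ∀ {N} n {f g : Vec (Fin N) n → Carrier} → (∀ w → f w ≈ g w) → sumV n f ≈ sumV n g
  sumV-cong zero    f≈g = f≈g []
  sumV-cong (suc n) f≈g = sum-cong-≋ (λ i → sumV-cong n (λ w → f≈g (i ∷ w)))

  sumV-scale : ∀ {N} n r (f : Vec (Fin N) n → Carrier) → sumV n (λ w → r * f w) ≈ r * sumV n f
  sumV-scale zero    r f = refl
  sumV-scale (suc n) r f =
    trans (sum-cong-≋ (λ i → sumV-scale n r (λ w → f (i ∷ w)))) (sum-scale r (λ i → sumV n (λ w → f (i ∷ w))))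

  -- Exchanging the order of summation lets the last letter be singled out instead of the first;
  -- this absorbs the rotation of a colouring.
  sumV-∷ʳ : ∀ {N} n (f : Vec (Fin N) (suc n) → Carrier) → sumV (suc n) f ≈ sum (λ i → sumV n (λ w → f (w ∷ʳ i)))
  sumV-∷ʳ zero    f = refl
  sumV-∷ʳ (suc n) f = begin
    sum (λ j → sumV (suc n) (λ w → f (j ∷ w)))
      ≈⟨ sum-cong-≋ (λ j → sumV-∷ʳ n (λ w → f (j ∷ w))) ⟩
    sum (λ j → sum (λ i → sumV n (λ w → f (j ∷ (w ∷ʳ i)))))
      ≈⟨ ∑-comm (λ j i → sumV n (λ w → f (j ∷ (w ∷ʳ i)))) ⟩
    sum (λ i → sum (λ j → sumV n (λ w → f (j ∷ (w ∷ʳ i)))))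
      ∎

-- Polynomial identities used for series

module Identities {c ℓ} (A : CommutativeRing c ℓ) where
  open CommutativeRing A hiding (zero)
  open Sums A
  open Integers A
  open Solver using (solve; con; _:+_; _:*_; _:-_; _:=_)

  -- Effect of one more variable: E grows from `e` to `(1 + u) e`, p from `p` to `y + p`, and
  -- `(1 + u) y` may be replaced by `u`.
  p-step : ∀ {u y} e p → y + u * y ≈ u → (e + u * e) * (y + p) ≈ u * e + (e * p + u * (e * p))
  p-step {u} {y} e p y-eq = modulo e y-eq
    (solve 4 (λ e u y p →
        (e :+ u :* e) :* (y :+ p) :=
        u :* e :+ (e :* p :+ u :* (e :* p)) :+ e :* (y :+ u :* y :- u))
      refl e u y p)

  -- The new square `y * y` cancels, so only the cross term `2 y p` is new, and `(1 + u) y`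
  -- collapses to `u`.
  p²-p₂-step : ∀ {u y} e p q → y + u * y ≈ u →
    (e + u * e) * ((y + p) * (y + p) - (y * y + q)) ≈
    ι (+ 2) * (u * (e * p)) + (e * (p * p - q) + u * (e * (p * p - q)))
  p²-p₂-step {u} {y} e p q y-eq = modulo (ι (+ 2) * e * p) y-eq
    (solve 5 (λ e u y p q →
        (e :+ u :* e) :* ((y :+ p) :* (y :+ p) :- (y :* y :+ q)) :=
        con (+ 2) :* (u :* (e :* p)) :+ (e :* (p :* p :- q) :+ u :* (e :* (p :* p :- q)))
          :+ con (+ 2) :* e :* p :* (y :+ u :* y :- u))
      refl e u y p q)

  -- Here `u`, `v`, `d` stand for ΣX, (ΣX)² - ΣX² and p² - p₂. The factor E is attached to `p` and
  -- `d`, where the products have explicit coefficients; `u` and `v` are monomials in z and merely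
  -- shift indices.
  distribute : ∀ e p d u v →
    e * (v * (ι (+ 2) - p) + ι (+ 2) * u * d - ι (+ 6) * u * p + ι (+ 6) * u - ι (+ 6) * p + ι (+ 4) * d) ≈
    v * (ι (+ 2) * e - e * p) +
      (u * (ι (+ 2) * (e * d) - ι (+ 6) * (e * p) + ι (+ 6) * e) + (ι (+ 4) * (e * d) - ι (+ 6) * (e * p)))
  distribute = solve 5 (λ e p d u v →
    e :* (v :* (con (+ 2) :- p) :+ con (+ 2) :* u :* d :- con (+ 6) :* u :* p :+ con (+ 6) :* u :- con (+ 6) :* p :+ con (+ 4) :* d) :=
    v :* (con (+ 2) :* e :- e :* p) :+
      (u :* (con (+ 2) :* (e :* d) :- con (+ 6) :* (e :* p) :+ con (+ 6) :* e) :+ (con (+ 4) :* (e :* d) :- con (+ 6) :* (e :* p))))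
    refl

  s-step : ∀ {s} p a b → s ≈ p - b - a → s * (1# - p + s) ≈ (p - a - b) * (1# - a - b)
  s-step {s} p a b s≈ = trans (*-cong s≈ (+-congˡ s≈))
    (solve 3 (λ p a b → (p :- b :- a) :* (con (+ 1) :- p :+ (p :- b :- a)) := (p :- a :- b) :* (con (+ 1) :- a :- b)) refl p a b)

-- Transfer equations for walks and their sum over pairs of colours

module Geometric {c ℓ} (A : CommutativeRing c ℓ) where
  open CommutativeRing A hiding (zero)
  open Sums A
  open Integers A
  open Solver using (solve; con; _:+_; _:*_; _:-_; _:=_)
  open SetoidReasoning setoid

  module Family {N : ℕ} (X y : Fin N → Carrier) (y-eq : ∀ i → y i + X i * y i ≈ X i) where

    p : Carrier
    p = sum y

    module Walks (t G : Fin N → Carrier) (t-idem : ∀ i → t i * t i ≈ t i)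
                 (G-eq : ∀ i → G i ≈ X i * (t i + (sum G - G i))) where

      s Q : Carrier
      s = sum (λ i → t i * y i)
      Q = sum (λ i → t i * G i)

      -- The series `1 - y i` plays the role of 1 / (1 + X i), hence its appearance as the cofactor
      -- of `G-eq`.
      G≈ : ∀ i → G i ≈ y i * (t i + sum G)
      G≈ i = modulo (G i - (sum G + t i)) (y-eq i) (modulo (1# - y i) (G-eq i)
        (solve 5 (λ g x y t T →
            g := y :* (t :+ T) :+ (g :- (T :+ t)) :* (y :+ x :* y :- x) :+ (con (+ 1) :- y) :* (g :- x :* (t :+ (T :- g))))
          refl (G i) (X i) (y i) (t i) (sum G)))

      sum-G : sum G ≈ s + p * sum G
      sum-G = begin
        sum G                                     ≈⟨ sum-cong-≋ (λ i → trans (G≈ i) (expand (y i) (t i) (sum G))) ⟩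
        sum (λ i → t i * y i + sum G * y i)       ≈⟨ ∑-distrib-+ (λ i → t i * y i) (λ i → sum G * y i) ⟩
        s + sum (λ i → sum G * y i)               ≈⟨ +-congˡ (trans (sum-scale (sum G) y) (*-comm _ _)) ⟩
        s + p * sum G                             ∎
        where
        expand : ∀ y t T → y * (t + T) ≈ t * y + T * y
        expand = solve 3 (λ y t T → y :* (t :+ T) := t :* y :+ T :* y) refl

      Q≈ : Q ≈ s + s * sum G
      Q≈ = begin
        sum (λ i → t i * G i)                             ≈⟨ sum-cong-≋ step ⟩
        sum (λ i → t i * y i + sum G * (t i * y i))       ≈⟨ ∑-distrib-+ (λ i → t i * y i) (λ i → sum G * (t i * y i)) ⟩
        s + sum (λ i → sum G * (t i * y i))               ≈⟨ +-congˡ (trans (sum-scale (sum G) (λ i → t i * y i)) (*-comm _ _)) ⟩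
        s + s * sum G                                     ∎
        where
        step : ∀ i → t i * G i ≈ t i * y i + sum G * (t i * y i)
        step i = trans (*-congˡ (G≈ i)) (modulo (y i) (t-idem i)
          (solve 3 (λ y t T → t :* (y :* (t :+ T)) := t :* y :+ T :* (t :* y) :+ y :* (t :* t :- t)) refl (y i) (t i) (sum G)))

      -- Since `sum-G` says that (1 - p) times `sum G` is `s`, multiplying `Q≈` by 1 - p eliminates
      -- the unknown sum without a division.
      walks : (1# - p) * Q ≈ s * (1# - p + s)
      walks = trans (*-congˡ Q≈) (modulo s sum-G
        (solve 3 (λ p s T → (con (+ 1) :- p) :* (s :+ s :* T) := s :* (con (+ 1) :- p :+ s) :+ s :* (T :- (s :+ p :* T)))
          refl p s (sum G)))

    X₁ : Carrier
    X₁ = sum X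

    X₂ p₂ : Carrier
    X₂ = sum (λ i → X i * X i)
    p₂ = sum (λ i → y i * y i)

    private
      -- A polynomial expression that makes sense for a = b too, although there it no longer
      -- describes walks. The sum over a ≠ b can thus be taken as the full double sum minus the
      -- diagonal.
      f : Fin N → Fin N → Carrier
      f a b = X a * (X b * ((p - y a - y b) * (1# - y a - y b)))

      w : Fin N → Carrier
      w a = p * y a - y a * y a

      sum-w : sum w ≈ p * p - p₂
      sum-w = trans (sum-sub (λ a → p * y a) (λ a → y a * y a)) (+-congʳ (sum-scale p y))

      -- Once the mixed products X y are eliminated, every term is a function of `a` times a
      -- function of `b`, so the double sum factors into single sums.
      f-separated : ∀ a b → f a b ≈
        X a * w b + (w a * X b + (ι -[1+ 0 ] * p * X a * X b + ι (+ 2) * (X a - y a) * (X b - y b)))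
      f-separated a b =
        modulo (X a * (y b - p) + ι (+ 2) * X a * y a) (y-eq b)
          (modulo (ι (+ 2) * (X b - y b) + X b * (y a - p)) (y-eq a)
            (solve 5 (λ p u v x y →
               u :* (v :* ((p :- x :- y) :* (con (+ 1) :- x :- y))) :=
               u :* (p :* y :- y :* y) :+ ((p :* x :- x :* x) :* v :+
                 (con -[1+ 0 ] :* p :* u :* v :+ con (+ 2) :* (u :- x) :* (v :- y)))
               :+ (u :* (y :- p) :+ con (+ 2) :* u :* x) :* (y :+ v :* y :- v)
               :+ (con (+ 2) :* (v :- y) :+ v :* (x :- p)) :* (x :+ u :* x :- u))
              refl p (X a) (X b) (y a) (y b)))

      -- With one index left, `X y = X - y` reduces all mixed powers to combinations of X², X, y and
      -- y².
      f-diagonal : ∀ a → f a a ≈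
        (ι (+ 2) - p) * (X a * X a) + ((ι (+ 2) * p - ι (+ 6)) * X a + ((ι (+ 6) - ι (+ 2) * p) * y a + ι (+ 4) * (y a * y a)))
      f-diagonal a =
        modulo (ι (+ 4) * (X a - y a + X a * y a - ι (+ 2)) - ι (+ 2) * (p + 1#) * (X a - 1#)) (y-eq a)
          (solve 3 (λ p u x →
             u :* (u :* ((p :- x :- x) :* (con (+ 1) :- x :- x))) :=
             (con (+ 2) :- p) :* (u :* u) :+ ((con (+ 2) :* p :- con (+ 6)) :* u :+
               ((con (+ 6) :- con (+ 2) :* p) :* x :+ con (+ 4) :* (x :* x)))
             :+ (con (+ 4) :* (u :- x :+ u :* x :- con (+ 2)) :- con (+ 2) :* (p :+ con (+ 1)) :* (u :- con (+ 1)))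
                 :* (x :+ u :* x :- u))
            refl p (X a) (y a))

      sum₂-distrib-+ : (g h : Fin N → Fin N → Carrier) →
        sum (λ a → sum (λ b → g a b + h a b)) ≈ sum (λ a → sum (g a)) + sum (λ a → sum (h a))
      sum₂-distrib-+ g h =
        trans (sum-cong-≋ (λ a → ∑-distrib-+ (g a) (h a))) (∑-distrib-+ (λ a → sum (g a)) (λ a → sum (h a)))

      sum-f : sum (λ a → sum (f a)) ≈
        X₁ * (p * p - p₂) + ((p * p - p₂) * X₁ + (ι -[1+ 0 ] * p * X₁ * X₁ + ι (+ 2) * (X₁ - p) * (X₁ - p)))
      sum-f = begin
        sum (λ a → sum (f a))
          ≈⟨ sum-cong-≋ (λ a → sum-cong-≋ (λ b → f-separated a b)) ⟩
        sum (λ a → sum (λ b → f₁ a b + (f₂ a b + (f₃ a b + f₄ a b))))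
          ≈⟨ trans (sum₂-distrib-+ f₁ (λ a b → f₂ a b + (f₃ a b + f₄ a b)))
               (+-congˡ (trans (sum₂-distrib-+ f₂ (λ a b → f₃ a b + f₄ a b)) (+-congˡ (sum₂-distrib-+ f₃ f₄)))) ⟩
        sum (λ a → sum (f₁ a)) + (sum (λ a → sum (f₂ a)) + (sum (λ a → sum (f₃ a)) + sum (λ a → sum (f₄ a))))
          ≈⟨ +-cong (trans (sum-product X w) (*-congˡ sum-w))
               (+-cong (trans (sum-product w X) (*-congʳ sum-w))
                 (+-cong (trans (sum-product (λ a → ι -[1+ 0 ] * p * X a) X) (*-congʳ (sum-scale (ι -[1+ 0 ] * p) X)))
                   (trans (sum-product (λ a → ι (+ 2) * (X a - y a)) (λ b → X b - y b))
                     (*-cong (trans (sum-scale (ι (+ 2)) (λ a → X a - y a)) (*-congˡ (sum-sub X y))) (sum-sub X y))))) ⟩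
        X₁ * (p * p - p₂) + ((p * p - p₂) * X₁ + (ι -[1+ 0 ] * p * X₁ * X₁ + ι (+ 2) * (X₁ - p) * (X₁ - p)))
          ∎
        where
        f₁ f₂ f₃ f₄ : Fin N → Fin N → Carrier
        f₁ a b = X a * w b
        f₂ a b = w a * X b
        f₃ a b = ι -[1+ 0 ] * p * X a * X b
        f₄ a b = ι (+ 2) * (X a - y a) * (X b - y b)

      sum-f-diagonal : sum (λ a → f a a) ≈
        (ι (+ 2) - p) * X₂ + ((ι (+ 2) * p - ι (+ 6)) * X₁ + ((ι (+ 6) - ι (+ 2) * p) * p + ι (+ 4) * p₂))
      sum-f-diagonal = begin
        sum (λ a → f a a)
          ≈⟨ sum-cong-≋ f-diagonal ⟩
        sum (λ a → g₁ a + (g₂ a + (g₃ a + g₄ a)))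
          ≈⟨ trans (∑-distrib-+ g₁ (λ a → g₂ a + (g₃ a + g₄ a)))
               (+-congˡ (trans (∑-distrib-+ g₂ (λ a → g₃ a + g₄ a)) (+-congˡ (∑-distrib-+ g₃ g₄)))) ⟩
        sum g₁ + (sum g₂ + (sum g₃ + sum g₄))
          ≈⟨ +-cong (sum-scale _ (λ a → X a * X a)) (+-cong (sum-scale _ X) (+-cong (sum-scale _ y) (sum-scale _ (λ a → y a * y a)))) ⟩
        (ι (+ 2) - p) * X₂ + ((ι (+ 2) * p - ι (+ 6)) * X₁ + ((ι (+ 6) - ι (+ 2) * p) * p + ι (+ 4) * p₂))
          ∎
        where
        g₁ g₂ g₃ g₄ : Fin N → Carrier
        g₁ a = (ι (+ 2) - p) * (X a * X a)
        g₂ a = (ι (+ 2) * p - ι (+ 6)) * X a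
        g₃ a = (ι (+ 6) - ι (+ 2) * p) * y a
        g₄ a = ι (+ 4) * (y a * y a)

    -- The squares survive only as X₁² - X₂ and p² - p₂, which are twice the second elementary
    -- symmetric functions of the X and of the y. These are the combinations that become explicit
    -- after multiplication by E.
    twinned-walks : (Q : Fin N → Fin N → Carrier) →
      (∀ a b → a ≢ b → (1# - p) * Q a b ≈ (p - y a - y b) * (1# - y a - y b)) →
      (1# - p) * sum (λ a → sum (λ b → ind (¬? (a Fin.≟ b)) * (X a * (X b * Q a b)))) ≈
      (X₁ * X₁ - X₂) * (ι (+ 2) - p) + ι (+ 2) * X₁ * (p * p - p₂) - ι (+ 6) * X₁ * p
        + ι (+ 6) * X₁ - ι (+ 6) * p + ι (+ 4) * (p * p - p₂)
    twinned-walks Q Q-eq = begin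
      (1# - p) * sum (λ a → sum (λ b → ind (¬? (a Fin.≟ b)) * (X a * (X b * Q a b))))
        ≈⟨ sum-scale (1# - p) (λ a → sum (λ b → ind (¬? (a Fin.≟ b)) * (X a * (X b * Q a b)))) ⟨
      sum (λ a → (1# - p) * sum (λ b → ind (¬? (a Fin.≟ b)) * (X a * (X b * Q a b))))
        ≈⟨ sum-cong-≋ (λ a → sum-scale (1# - p) (λ b → ind (¬? (a Fin.≟ b)) * (X a * (X b * Q a b)))) ⟨
      sum (λ a → sum (λ b → (1# - p) * (ind (¬? (a Fin.≟ b)) * (X a * (X b * Q a b)))))
        ≈⟨ sum-cong-≋ (λ a → sum-cong-≋ (λ b → trans (pull (1# - p) (ind (¬? (a Fin.≟ b))) (X a) (X b) (Q a b))
             (ind-guard (¬? (a Fin.≟ b)) (λ a≢b → *-congˡ (*-congˡ (Q-eq a b a≢b)))))) ⟩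
      sum (λ a → sum (λ b → ind (¬? (a Fin.≟ b)) * f a b))
        ≈⟨ sum-off-diagonal f ⟩
      sum (λ a → sum (f a)) - sum (λ a → f a a)
        ≈⟨ +-cong sum-f (-‿cong sum-f-diagonal) ⟩
      _
        ≈⟨ solve 4 (λ p q u v →
             u :* (p :* p :- q) :+ ((p :* p :- q) :* u :+ (con -[1+ 0 ] :* p :* u :* u :+ con (+ 2) :* (u :- p) :* (u :- p)))
             :- ((con (+ 2) :- p) :* v :+ ((con (+ 2) :* p :- con (+ 6)) :* u :+ ((con (+ 6) :- con (+ 2) :* p) :* p :+ con (+ 4) :* q)))
             := (u :* u :- v) :* (con (+ 2) :- p) :+ con (+ 2) :* u :* (p :* p :- q) :- con (+ 6) :* u :* p
                :+ con (+ 6) :* u :- con (+ 6) :* p :+ con (+ 4) :* (p :* p :- q))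
           refl p p₂ X₁ X₂ ⟩
      (X₁ * X₁ - X₂) * (ι (+ 2) - p) + ι (+ 2) * X₁ * (p * p - p₂) - ι (+ 6) * X₁ * p
        + ι (+ 6) * X₁ - ι (+ 6) * p + ι (+ 4) * (p * p - p₂)
        ∎
      where
      pull : ∀ r i x y q → r * (i * (x * (y * q))) ≈ i * (x * (y * (r * q)))
      pull = solve 5 (λ r i x y q → r :* (i :* (x :* (y :* q))) := i :* (x :* (y :* (r :* q)))) refl

outside? : ∀ {N} (a b c : Fin N) → Dec (a ≢ c × b ≢ c)
outside? a b c = ¬? (a Fin.≟ c) ×-dec ¬? (b Fin.≟ c)

-- Elementary symmetric functions and the series p and p₂

module GeneratingFunctions {c ℓ} (R : CommutativeRing c ℓ) where
  open CommutativeRing R hiding (zero)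
  open PowerSeries R
  open Integers R
  open Solver using (solve; con; _:+_; _:*_; _:-_; _:=_)
  open Sums R
  private
    module S    = CommutativeRing R[[z]]
    module ιS   = Integers R[[z]]
    module ∑S   = Sums R[[z]]
  open Identities R[[z]]
  open SetoidReasoning setoid

  X : ∀ {N} → (Fin N → Carrier) → Fin N → ℕ → Carrier
  X x i = shift (const (x i))

  X-⊛ : ∀ {N} (x : Fin N → Carrier) i f → X x i ⊛ f ≐ shift (λ n → x i * f n)
  X-⊛ x i f = shift-const-⊛ (x i) f

  -- The series r z / (1 + r z).
  geometric : Carrier → ℕ → Carrier
  geometric r zero    = 0#
  geometric r (suc n) = r * (const 1# n - geometric r n)

  y : ∀ {N} → (Fin N → Carrier) → Fin N → ℕ → Carrier
  y x i = geometric (x i)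

  y-eq : ∀ {N} (x : Fin N → Carrier) i → y x i S.+ X x i ⊛ y x i ≐ X x i
  y-eq x i zero    = trans (+-identityˡ _) (X-⊛ x i (y x i) zero)
  y-eq x i (suc n) = begin
    x i * (const 1# n - y x i n) + (X x i ⊛ y x i) (suc n)
      ≈⟨ +-congˡ (X-⊛ x i (y x i) (suc n)) ⟩
    x i * (const 1# n - y x i n) + x i * y x i n
      ≈⟨ solve 3 (λ x c y → x :* (c :- y) :+ x :* y := x :* c) refl (x i) (const 1# n) (y x i n) ⟩
    x i * const 1# n
      ≈⟨ scale n ⟩
    const (x i) n
      ∎
    where
    scale : ∀ n → x i * const 1# n ≈ const (x i) n
    scale zero    = *-identityʳ _
    scale (suc n) = zeroʳ _

  -- The coefficient of z^k in the product of the factors 1 + x i z, built up one variable at a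
  -- time.
  elem : ∀ {N} → (Fin N → Carrier) → ℕ → Carrier
  elem {zero}  x   = const 1#
  elem {suc N} x k = elem (x ∘ suc) k + shift (λ j → x zero * elem (x ∘ suc) j) k

  elem-0 : ∀ {N} (x : Fin N → Carrier) → elem x 0 ≈ 1#
  elem-0 {zero}  x = refl
  elem-0 {suc N} x = trans (+-identityʳ _) (elem-0 (x ∘ suc))

  elem-1 : ∀ {N} (x : Fin N → Carrier) → elem x 1 ≈ sum x
  elem-1 {zero}  x = refl
  elem-1 {suc N} x =
    trans (+-cong (elem-1 (x ∘ suc)) (trans (*-congˡ (elem-0 (x ∘ suc))) (*-identityʳ _))) (+-comm _ _)

  elem-2 : ∀ {N} (x : Fin N → Carrier) → sum x * sum x - sum (λ i → x i * x i) ≈ ι (+ 2) * elem x 2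
  elem-2 {zero}  x = solve 0 (con (+ 0) :* con (+ 0) :- con (+ 0) := con (+ 2) :* con (+ 0)) refl
  elem-2 {suc N} x = begin
    (x zero + s) * (x zero + s) - (x zero * x zero + s₂)
      ≈⟨ solve 3 (λ x s t → (x :+ s) :* (x :+ s) :- (x :* x :+ t) := (s :* s :- t) :+ con (+ 2) :* (x :* s)) refl (x zero) s s₂ ⟩
    (s * s - s₂) + ι (+ 2) * (x zero * s)
      ≈⟨ +-cong (elem-2 (x ∘ suc)) (*-congˡ (*-congˡ (sym (elem-1 (x ∘ suc))))) ⟩
    ι (+ 2) * elem (x ∘ suc) 2 + ι (+ 2) * (x zero * elem (x ∘ suc) 1)
      ≈⟨ distribˡ _ _ _ ⟨
    ι (+ 2) * elem x 2
      ∎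
    where
    s s₂ : Carrier
    s  = sum (x ∘ suc)
    s₂ = sum (λ i → x (suc i) * x (suc i))

  elem-suc : ∀ {N} (x : Fin (suc N) → Carrier) → elem x ≐ elem (x ∘ suc) S.+ X x zero ⊛ elem (x ∘ suc)
  elem-suc x k = +-congˡ (sym (X-⊛ x zero (elem (x ∘ suc)) k))

  p p₂ : ∀ {N} → (Fin N → Carrier) → ℕ → Carrier
  p  x = ∑S.sum (y x)
  p₂ x = ∑S.sum (λ i → y x i ⊛ y x i)

  d : ∀ {N} → (Fin N → Carrier) → ℕ → Carrier
  d x = p x ⊛ p x S.- p₂ x

  -- E times `y x i` is X i times the product of 1 + X j over j ≠ i. Summed over i, each squarefree
  -- monomial is counted once for every variable that it contains.
  elem-p : ∀ {N} (x : Fin N → Carrier) → elem x ⊛ p x ≐ (λ k → ι (+ k) * elem x k)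
  elem-p {zero}  x zero    = trans (zeroʳ _) (sym (zeroˡ _))
  elem-p {zero}  x (suc k) = trans (S.zeroʳ (const 1#) (suc k)) (sym (zeroʳ _))
  elem-p {suc N} x k = trans (S.trans (S.*-congʳ (elem-suc x)) (p-step E′ p′ (y-eq x zero)) k) (coefficient k)
    where
    E′ p′ : ℕ → Carrier
    E′ = elem (x ∘ suc)
    p′ = p (x ∘ suc)

    coefficient : X x zero ⊛ E′ S.+ (E′ ⊛ p′ S.+ X x zero ⊛ (E′ ⊛ p′)) ≐ (λ k → ι (+ k) * elem x k)
    coefficient zero = begin
      (X x zero ⊛ E′) 0 + ((E′ ⊛ p′) 0 + (X x zero ⊛ (E′ ⊛ p′)) 0)
        ≈⟨ +-cong (X-⊛ x zero E′ 0) (+-cong (elem-p (x ∘ suc) 0) (X-⊛ x zero (E′ ⊛ p′) 0)) ⟩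
      0# + (0# * E′ 0 + 0#)
        ≈⟨ solve 1 (λ e → con (+ 0) :+ (con (+ 0) :* e :+ con (+ 0)) := con (+ 0) :* (e :+ con (+ 0))) refl (E′ 0) ⟩
      0# * (E′ 0 + 0#)
        ∎
    coefficient (suc k) = begin
      (X x zero ⊛ E′) (suc k) + ((E′ ⊛ p′) (suc k) + (X x zero ⊛ (E′ ⊛ p′)) (suc k))
        ≈⟨ +-cong (X-⊛ x zero E′ (suc k)) (+-cong (trans (elem-p (x ∘ suc) (suc k)) (*-congʳ (ι-suc (+ k))))
             (trans (X-⊛ x zero (E′ ⊛ p′) (suc k)) (*-congˡ (elem-p (x ∘ suc) k)))) ⟩
      x zero * E′ k + ((1# + ι (+ k)) * E′ (suc k) + x zero * (ι (+ k) * E′ k))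
        ≈⟨ solve 4 (λ x e f n → x :* e :+ ((con (+ 1) :+ n) :* f :+ x :* (n :* e)) := (con (+ 1) :+ n) :* (f :+ x :* e))
             refl (x zero) (E′ k) (E′ (suc k)) (ι (+ k)) ⟩
      (1# + ι (+ k)) * (E′ (suc k) + x zero * E′ k)
        ≈⟨ *-congʳ (ι-suc (+ k)) ⟨
      ι (+ suc k) * elem x (suc k)
        ∎

  -- As in `elem-p`, but with an ordered pair of distinct variables marked in each squarefree
  -- monomial.
  elem-d : ∀ {N} (x : Fin N → Carrier) → elem x ⊛ d x ≐ (λ k → ι (+ k) * (ι (+ k) - 1#) * elem x k)
  elem-d {zero}  x k = begin
    (const 1# ⊛ d x) k                        ≈⟨ S.*-identityˡ (d x) k ⟩
    ((λ _ → 0#) ⊛ (λ _ → 0#)) k - 0#          ≈⟨ +-congʳ (S.zeroˡ (λ _ → 0#) k) ⟩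
    0# - 0#                                   ≈⟨ vanish k ⟩
    ι (+ k) * (ι (+ k) - 1#) * const 1# k     ∎
    where
    vanish : ∀ k → 0# - 0# ≈ ι (+ k) * (ι (+ k) - 1#) * const 1# k
    vanish zero    = solve 0 (con (+ 0) :- con (+ 0) := con (+ 0) :* (con (+ 0) :- con (+ 1)) :* con (+ 1)) refl
    vanish (suc k) = trans (-‿inverseʳ 0#) (sym (zeroʳ _))
  elem-d {suc N} x k =
    trans (S.trans (S.*-congʳ (elem-suc x)) (p²-p₂-step E′ (p (x ∘ suc)) (p₂ (x ∘ suc)) (y-eq x zero)) k) (coefficient k)
    where
    E′ P′ D′ : ℕ → Carrier
    E′ = elem (x ∘ suc)
    P′ = E′ ⊛ p (x ∘ suc)
    D′ = E′ ⊛ d (x ∘ suc)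

    coefficient : ιS.ι (+ 2) ⊛ (X x zero ⊛ P′) S.+ (D′ S.+ X x zero ⊛ D′) ≐ (λ k → ι (+ k) * (ι (+ k) - 1#) * elem x k)
    coefficient zero = begin
      (ιS.ι (+ 2) ⊛ (X x zero ⊛ P′)) 0 + (D′ 0 + (X x zero ⊛ D′) 0)
        ≈⟨ +-cong (trans (ι-⊛ (+ 2) (X x zero ⊛ P′) 0) (*-congˡ (X-⊛ x zero P′ 0)))
             (+-cong (elem-d (x ∘ suc) 0) (X-⊛ x zero D′ 0)) ⟩
      ι (+ 2) * 0# + (0# * (0# - 1#) * E′ 0 + 0#)
        ≈⟨ solve 1 (λ e → con (+ 2) :* con (+ 0) :+ (con (+ 0) :* (con (+ 0) :- con (+ 1)) :* e :+ con (+ 0)) :=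
                          con (+ 0) :* (con (+ 0) :- con (+ 1)) :* (e :+ con (+ 0))) refl (E′ 0) ⟩
      0# * (0# - 1#) * (E′ 0 + 0#)
        ∎
    coefficient (suc k) = begin
      (ιS.ι (+ 2) ⊛ (X x zero ⊛ P′)) (suc k) + (D′ (suc k) + (X x zero ⊛ D′) (suc k))
        ≈⟨ +-cong (trans (ι-⊛ (+ 2) (X x zero ⊛ P′) (suc k))
                    (*-congˡ (trans (X-⊛ x zero P′ (suc k)) (*-congˡ (elem-p (x ∘ suc) k)))))
             (+-cong (trans (elem-d (x ∘ suc) (suc k)) (*-congʳ (*-cong (ι-suc (+ k)) (+-congʳ (ι-suc (+ k))))))
               (trans (X-⊛ x zero D′ (suc k)) (*-congˡ (elem-d (x ∘ suc) k)))) ⟩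
      ι (+ 2) * (x zero * (ι (+ k) * E′ k)) +
        ((1# + ι (+ k)) * (1# + ι (+ k) - 1#) * E′ (suc k) + x zero * (ι (+ k) * (ι (+ k) - 1#) * E′ k))
        ≈⟨ solve 4 (λ x e f n →
             con (+ 2) :* (x :* (n :* e)) :+
               ((con (+ 1) :+ n) :* (con (+ 1) :+ n :- con (+ 1)) :* f :+ x :* (n :* (n :- con (+ 1)) :* e)) :=
             (con (+ 1) :+ n) :* (con (+ 1) :+ n :- con (+ 1)) :* (f :+ x :* e))
             refl (x zero) (E′ k) (E′ (suc k)) (ι (+ k)) ⟩
      (1# + ι (+ k)) * (1# + ι (+ k) - 1#) * (E′ (suc k) + x zero * E′ k)
        ≈⟨ *-congʳ (*-cong (ι-suc (+ k)) (+-congʳ (ι-suc (+ k)))) ⟨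
      ι (+ suc k) * (ι (+ suc k) - 1#) * elem x (suc k)
        ∎

-- Generating function of the twinned cycles

module TwinnedCycles {c ℓ} (R : CommutativeRing c ℓ) {N : ℕ} (x : Fin N → CommutativeRing.Carrier R) where
  open CommutativeRing R hiding (zero)
  open PowerSeries R
  open Integers R
  open Solver using (solve; con; _:+_; _:*_; _:-_; _:=_)
  open Sums R
  open GeneratingFunctions R
  private
    module S  = CommutativeRing R[[z]]
    module ιS = Integers R[[z]]
    module ∑S = Sums R[[z]]
    module I  = Identities R[[z]]
    module Γ  = Geometric.Family R[[z]] (X x) (y x) (y-eq x)
  open SetoidReasoning setoid

  -- The coefficient of zⁿ enumerates the words of length n that start with i,
  -- end in a letter other than a and b, and have no two equal adjacent letters.
  G : (a b : Fin N) → Fin N → ℕ → Carrier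
  G a b i zero    = 0#
  G a b i (suc n) = x i * (const (ind (outside? a b i)) n + (sum (λ j → G a b j n) - G a b i n))

  ind-const : ∀ {P : Set} (d : Dec P) → const (ind d) ≐ ∑S.ind d
  ind-const (yes _) k       = refl
  ind-const (no _)  zero    = refl
  ind-const (no _)  (suc k) = refl

  ind-⊛ : ∀ {P : Set} (d : Dec P) f → ∑S.ind d ⊛ f ≐ (λ n → ind d * f n)
  ind-⊛ d f n = trans (⊛-cong (λ k → sym (ind-const d k)) (λ _ → refl) n) (const-⊛ (ind d) f n)

  G-eq : ∀ a b i → G a b i ≐ X x i ⊛ (∑S.ind (outside? a b i) S.+ (∑S.sum (G a b) S.- G a b i))
  G-eq a b i zero    = sym (X-⊛ x i (∑S.ind (outside? a b i) S.+ (∑S.sum (G a b) S.- G a b i)) zero)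
  G-eq a b i (suc n) = sym (trans (X-⊛ x i _ (suc n))
    (*-congˡ (+-cong (sym (ind-const (outside? a b i) n)) (+-congʳ (sum-coefficient (G a b) n)))))

  -- `G` already constrains the last letter; the additional indicator constrains the first one. For
  -- words of length one both conditions fall on the same letter.
  Q : (a b : Fin N) → ℕ → Carrier
  Q a b = ∑S.sum (λ i → ∑S.ind (outside? a b i) ⊛ G a b i)

  ind-idem : ∀ {P : Set} (d : Dec P) → ∑S.ind d ⊛ ∑S.ind d ≐ ∑S.ind d
  ind-idem (yes _) = S.*-identityˡ (const 1#)
  ind-idem (no _)  = S.zeroˡ (λ _ → 0#)

  sum-outside : ∀ {a b} → a ≢ b → ∑S.sum (λ i → ∑S.ind (outside? a b i) ⊛ y x i) ≐ p x S.- y x b S.- y x a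
  sum-outside {a} {b} a≢b = S.trans
    (∑S.sum-cong-≋ (λ i → S.trans (S.*-congʳ (∑S.ind-× (¬? (a Fin.≟ i)) (¬? (b Fin.≟ i)))) (S.*-assoc _ _ (y x i))))
    (S.trans (∑S.sum-≢ a (λ i → ∑S.ind (¬? (b Fin.≟ i)) ⊛ y x i))
      (S.+-cong (∑S.sum-≢ b (y x)) (S.-‿cong (b≢a (b Fin.≟ a)))))
    where
    b≢a : (d : Dec (b ≡ a)) → ∑S.ind (¬? d) ⊛ y x a ≐ y x a
    b≢a (yes b≡a) = contradiction (≡.sym b≡a) a≢b
    b≢a (no _)    = S.*-identityˡ (y x a)

  Q-eq : ∀ a b → a ≢ b → (S.1# S.- p x) ⊛ Q a b ≐ (p x S.- y x a S.- y x b) ⊛ (S.1# S.- y x a S.- y x b)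
  Q-eq a b a≢b = S.trans
    (Γ.Walks.walks (λ i → ∑S.ind (outside? a b i)) (G a b) (λ i → ind-idem (outside? a b i)) (G-eq a b))
    (I.s-step (p x) (y x a) (y x b) (sum-outside a≢b))

  F : ℕ → Carrier
  F = ∑S.sum (λ a → ∑S.sum (λ b → ∑S.ind (¬? (a Fin.≟ b)) ⊛ (X x a ⊛ (X x b ⊛ Q a b))))

  F-coefficient : ∀ k → F k ≈
    sum (λ a → sum (λ b → ind (¬? (a Fin.≟ b)) * shift (λ n → x a * shift (λ n → x b * Q a b n) n) k))
  F-coefficient k = begin
    F k
      ≈⟨ sum-coefficient (λ a → ∑S.sum (λ b → ∑S.ind (¬? (a Fin.≟ b)) ⊛ (X x a ⊛ (X x b ⊛ Q a b)))) k ⟩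
    sum (λ a → ∑S.sum (λ b → ∑S.ind (¬? (a Fin.≟ b)) ⊛ (X x a ⊛ (X x b ⊛ Q a b))) k)
      ≈⟨ sum-cong-≋ (λ a → sum-coefficient (λ b → ∑S.ind (¬? (a Fin.≟ b)) ⊛ (X x a ⊛ (X x b ⊛ Q a b))) k) ⟩
    sum (λ a → sum (λ b → (∑S.ind (¬? (a Fin.≟ b)) ⊛ (X x a ⊛ (X x b ⊛ Q a b))) k))
      ≈⟨ sum-cong-≋ (λ a → sum-cong-≋ (λ b → trans (ind-⊛ (¬? (a Fin.≟ b)) _ k) (*-congˡ (XX a b k)))) ⟩
    sum (λ a → sum (λ b → ind (¬? (a Fin.≟ b)) * shift (λ n → x a * shift (λ n → x b * Q a b n) n) k))
      ∎
    where
    XX : ∀ a b → X x a ⊛ (X x b ⊛ Q a b) ≐ shift (λ n → x a * shift (λ n → x b * Q a b n) n)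
    XX a b zero    = X-⊛ x a (X x b ⊛ Q a b) zero
    XX a b (suc k) = trans (X-⊛ x a (X x b ⊛ Q a b) (suc k)) (*-congˡ (X-⊛ x b (Q a b) k))

  -- Index shift: H m belongs to the cycle on m + 2 vertices.
  H : ℕ → Carrier
  H m = sum (λ a → sum (λ b → ind (¬? (a Fin.≟ b)) *
          (x a * (x b * sum (λ i → ind (outside? a b i) * G a b i (suc m))))))

  Q-coefficient : ∀ a b k → Q a b k ≈ sum (λ i → ind (outside? a b i) * G a b i k)
  Q-coefficient a b k = trans (sum-coefficient (λ i → ∑S.ind (outside? a b i) ⊛ G a b i) k)
    (sum-cong-≋ (λ i → ind-⊛ (outside? a b i) (G a b i) k))

  -- The two colours a and b are followed by at least one letter, so F starts in degree 3.
  F≈H : ∀ m → F (3 ℕ.+ m) ≈ H m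
  F≈H m = trans (F-coefficient (3 ℕ.+ m))
    (sum-cong-≋ (λ a → sum-cong-≋ (λ b → *-congˡ (*-congˡ (*-congˡ (Q-coefficient a b (suc m)))))))

  F-low : ∀ k → (∀ a b → shift (λ n → x a * shift (λ n → x b * Q a b n) n) k ≈ 0#) → F k ≈ 0#
  F-low k z = trans (F-coefficient k)
    (sum-zero (λ a → sum-zero (λ b → trans (*-congˡ {ind (¬? (a Fin.≟ b))} (z a b)) (zeroʳ (ind (¬? (a Fin.≟ b)))))))

  F-0 : F 0 ≈ 0#
  F-0 = F-low 0 (λ a b → refl)

  F-1 : F 1 ≈ 0#
  F-1 = F-low 1 (λ a b → zeroʳ _)

  F-2 : F 2 ≈ 0#
  F-2 = F-low 2 (λ a b → trans (*-congˡ (trans (*-congˡ (trans (Q-coefficient a b 0)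
          (sum-zero (λ i → zeroʳ (ind (outside? a b i)))))) (zeroʳ _))) (zeroʳ _))

  -- Leading zeros of the right factor are not visible to the left-peeling definition of `⊛`;
  -- `⊛-last` removes them one by one.
  ⊛-shift₃ : ∀ f g → g 0 ≈ 0# → g 1 ≈ 0# → g 2 ≈ 0# → ∀ m → (f ⊛ g) (3 ℕ.+ m) ≈ (f ⊛ (λ k → g (3 ℕ.+ k))) m
  ⊛-shift₃ f g g0 g1 g2 m =
    trans (drop g (2 ℕ.+ m) g0) (trans (drop (tail g) (suc m) g1) (drop (tail (tail g)) m g2))
    where
    drop : ∀ h n → h 0 ≈ 0# → (f ⊛ h) (suc n) ≈ (f ⊛ tail h) n
    drop h n h0 = trans (⊛-last f h n) (trans (+-congˡ (trans (*-congˡ h0) (zeroʳ _))) (+-identityʳ _))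

  X₁≐ : Γ.X₁ ≐ shift (const (elem x 1))
  X₁≐ k = trans (sum-coefficient (X x) k) (case k)
    where
    case : ∀ k → sum (λ i → X x i k) ≈ shift (const (elem x 1)) k
    case zero          = sum-zero {N} (λ _ → refl)
    case (suc zero)    = sym (elem-1 x)
    case (suc (suc k)) = sum-zero {N} (λ _ → refl)

  -- The squares cancel, leaving the products of two distinct variables, each twice. This is the
  -- source of the negative e₂ term of the recurrence.
  X₁²-X₂≐ : Γ.X₁ ⊛ Γ.X₁ S.- Γ.X₂ ≐ shift (shift (const (ι (+ 2) * elem x 2)))
  X₁²-X₂≐ k = begin
    (Γ.X₁ ⊛ Γ.X₁) k - Γ.X₂ k
      ≈⟨ +-cong (trans (⊛-cong X₁≐ X₁≐ k) (shift-const-⊛ _ _ k))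
           (-‿cong (trans (sum-coefficient (λ i → X x i ⊛ X x i) k) (sum-cong-≋ (λ i → X-⊛ x i (X x i) k)))) ⟩
    shift (λ n → elem x 1 * shift (const (elem x 1)) n) k - sum (λ i → shift (λ n → x i * X x i n) k)
      ≈⟨ case k ⟩
    shift (shift (const (ι (+ 2) * elem x 2))) k
      ∎
    where
    0-0 : ∀ {u v} → u ≈ 0# → v ≈ 0# → u - v ≈ 0#
    0-0 u v = trans (+-cong u (-‿cong v)) (-‿inverseʳ 0#)

    case : ∀ k → shift (λ n → elem x 1 * shift (const (elem x 1)) n) k - sum (λ i → shift (λ n → x i * X x i n) k)
                 ≈ shift (shift (const (ι (+ 2) * elem x 2))) k
    case zero                = 0-0 refl (sum-zero {N} (λ _ → refl))
    case (suc zero)          = 0-0 (zeroʳ _) (sum-zero (λ i → zeroʳ (x i)))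
    case (suc (suc zero))    = trans (+-congʳ (*-cong (elem-1 x) (elem-1 x))) (elem-2 x)
    case (suc (suc (suc k))) = 0-0 (zeroʳ _) (sum-zero (λ i → zeroʳ (x i)))

  D : ℕ → Carrier
  D k = (1# - ι (+ k)) * elem x k

  D≐ : elem x ⊛ (S.1# S.- p x) ≐ D
  D≐ k = begin
    (elem x ⊛ (S.1# S.- p x)) k
      ≈⟨ S.trans (S.distribˡ (elem x) S.1# (S.- p x)) (S.+-cong (S.*-identityʳ (elem x)) (S.sym (-‿distribʳ-* (elem x) (p x)))) k ⟩
    elem x k - (elem x ⊛ p x) k
      ≈⟨ +-congˡ (-‿cong (elem-p x k)) ⟩
    elem x k - ι (+ k) * elem x k
      ≈⟨ solve 2 (λ n e → e :- n :* e := (con (+ 1) :- n) :* e) refl (ι (+ k)) (elem x k) ⟩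
    D k
      ∎
    where open RingProperties S.ring using (-‿distribʳ-*)

  -- Two evaluations of the coefficient of z^(m+3) in E (1 - p) F; the cycle on m + 2 vertices has m
  -- + 3 vertices after twinning.
  convolution : ∀ m → (D ⊛ H) m ≈
    ι (+ 2) * (ι (+ 3) + ι (+ m)) * (ι (+ 2) * ι (+ m) + 1#) * elem x (3 ℕ.+ m)
    + ι (+ 2) * (ι (+ m) + 1#) * (ι (+ m) - 1#) * (elem x 1 * elem x (2 ℕ.+ m))
    - ι (+ 2) * (ι (+ m) - 1#) * (elem x 2 * elem x (1 ℕ.+ m))
  convolution m = begin
    (D ⊛ H) m
      ≈⟨ ⊛-cong (λ _ → refl) F≈H m ⟨
    (D ⊛ (λ k → F (3 ℕ.+ k))) m
      ≈⟨ ⊛-shift₃ D F F-0 F-1 F-2 m ⟨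
    (D ⊛ F) (3 ℕ.+ m)
      ≈⟨ ⊛-cong D≐ (λ _ → refl) (3 ℕ.+ m) ⟨
    ((elem x ⊛ (S.1# S.- p x)) ⊛ F) (3 ℕ.+ m)
      ≈⟨ S.trans (S.*-assoc (elem x) (S.1# S.- p x) F) (S.*-congˡ {elem x} (Γ.twinned-walks Q Q-eq)) (3 ℕ.+ m) ⟩
    _
      ≈⟨ I.distribute (elem x) (p x) (d x) Γ.X₁ (Γ.X₁ ⊛ Γ.X₁ S.- Γ.X₂) (3 ℕ.+ m) ⟩
    ((Γ.X₁ ⊛ Γ.X₁ S.- Γ.X₂) ⊛ (ιS.ι (+ 2) ⊛ elem x S.- P)) (3 ℕ.+ m) +
      ((Γ.X₁ ⊛ (ιS.ι (+ 2) ⊛ Δ S.- ιS.ι (+ 6) ⊛ P S.+ ιS.ι (+ 6) ⊛ elem x)) (3 ℕ.+ m) +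
       ((ιS.ι (+ 4) ⊛ Δ) (3 ℕ.+ m) - (ιS.ι (+ 6) ⊛ P) (3 ℕ.+ m)))
      -- Multiplication by 2e₂ z² and by e₁ z lowers the index by two and by one.
      ≈⟨ +-cong (S₂-coefficient (ιS.ι (+ 2) ⊛ elem x S.- P) (suc m))
           (+-cong (S₁-coefficient (ιS.ι (+ 2) ⊛ Δ S.- ιS.ι (+ 6) ⊛ P S.+ ιS.ι (+ 6) ⊛ elem x) (2 ℕ.+ m)) refl) ⟩
    ι (+ 2) * elem x 2 * ((ιS.ι (+ 2) ⊛ elem x) (1 ℕ.+ m) - P (1 ℕ.+ m)) +
      (elem x 1 * ((ιS.ι (+ 2) ⊛ Δ) (2 ℕ.+ m) - (ιS.ι (+ 6) ⊛ P) (2 ℕ.+ m) + (ιS.ι (+ 6) ⊛ elem x) (2 ℕ.+ m)) +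
       ((ιS.ι (+ 4) ⊛ Δ) (3 ℕ.+ m) - (ιS.ι (+ 6) ⊛ P) (3 ℕ.+ m)))
      ≈⟨ +-cong (*-congˡ (+-cong (ι-⊛ (+ 2) (elem x) (1 ℕ.+ m)) (-‿cong (P-coefficient (1 ℕ.+ m) (+ 1) ≡.refl))))
           (+-cong (*-congˡ (+-cong (+-cong
               (trans (ι-⊛ (+ 2) Δ (2 ℕ.+ m)) (*-congˡ (Δ-coefficient (2 ℕ.+ m) (+ 2) ≡.refl)))
               (-‿cong (trans (ι-⊛ (+ 6) P (2 ℕ.+ m)) (*-congˡ (P-coefficient (2 ℕ.+ m) (+ 2) ≡.refl)))))
               (ι-⊛ (+ 6) (elem x) (2 ℕ.+ m))))
             (+-cong
               (trans (ι-⊛ (+ 4) Δ (3 ℕ.+ m)) (*-congˡ (Δ-coefficient (3 ℕ.+ m) (+ 3) ≡.refl)))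
               (-‿cong (trans (ι-⊛ (+ 6) P (3 ℕ.+ m)) (*-congˡ (P-coefficient (3 ℕ.+ m) (+ 3) ≡.refl)))))) ⟩
    ι (+ 2) * elem x 2 * (ι (+ 2) * elem x (1 ℕ.+ m) - (1# + μ) * elem x (1 ℕ.+ m)) +
      (elem x 1 * (ι (+ 2) * ((ι (+ 2) + μ) * (ι (+ 2) + μ - 1#) * elem x (2 ℕ.+ m))
                   - ι (+ 6) * ((ι (+ 2) + μ) * elem x (2 ℕ.+ m)) + ι (+ 6) * elem x (2 ℕ.+ m)) +
       (ι (+ 4) * ((ι (+ 3) + μ) * (ι (+ 3) + μ - 1#) * elem x (3 ℕ.+ m)) - ι (+ 6) * ((ι (+ 3) + μ) * elem x (3 ℕ.+ m))))
      ≈⟨ solve 6 (λ μ e₁ e₂ f₁ f₂ f₃ →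
           con (+ 2) :* e₂ :* (con (+ 2) :* f₁ :- (con (+ 1) :+ μ) :* f₁) :+
             (e₁ :* (con (+ 2) :* ((con (+ 2) :+ μ) :* (con (+ 2) :+ μ :- con (+ 1)) :* f₂)
                     :- con (+ 6) :* ((con (+ 2) :+ μ) :* f₂) :+ con (+ 6) :* f₂) :+
              (con (+ 4) :* ((con (+ 3) :+ μ) :* (con (+ 3) :+ μ :- con (+ 1)) :* f₃) :- con (+ 6) :* ((con (+ 3) :+ μ) :* f₃)))
           := con (+ 2) :* (con (+ 3) :+ μ) :* (con (+ 2) :* μ :+ con (+ 1)) :* f₃
              :+ con (+ 2) :* (μ :+ con (+ 1)) :* (μ :- con (+ 1)) :* (e₁ :* f₂)
              :- con (+ 2) :* (μ :- con (+ 1)) :* (e₂ :* f₁))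
         refl μ (elem x 1) (elem x 2) (elem x (1 ℕ.+ m)) (elem x (2 ℕ.+ m)) (elem x (3 ℕ.+ m)) ⟩
    _ ∎
    where
    P Δ : ℕ → Carrier
    P = elem x ⊛ p x
    Δ = elem x ⊛ d x

    μ : Carrier
    μ = ι (+ m)

    -- Splitting the index into a literal plus `m` leaves the solver with the single indeterminate
    -- `μ`.
    P-coefficient : ∀ k i → + k ≡ i ℤ.+ + m → P k ≈ (ι i + μ) * elem x k
    P-coefficient k i k≡ = trans (elem-p x k) (*-congʳ (trans (ι-cong k≡) (ι-+ i (+ m))))

    Δ-coefficient : ∀ k i → + k ≡ i ℤ.+ + m → Δ k ≈ (ι i + μ) * (ι i + μ - 1#) * elem x k
    Δ-coefficient k i k≡ = trans (elem-d x k) (*-congʳ (*-cong k≈ (+-congʳ k≈)))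
      where
      k≈ : ι (+ k) ≈ ι i + μ
      k≈ = trans (ι-cong k≡) (ι-+ i (+ m))

    S₁-coefficient : ∀ f n → (Γ.X₁ ⊛ f) (suc n) ≈ elem x 1 * f n
    S₁-coefficient f n = trans (⊛-cong {g = f} X₁≐ (λ _ → refl) (suc n)) (shift-const-⊛ (elem x 1) f (suc n))

    S₂-coefficient : ∀ f n → ((Γ.X₁ ⊛ Γ.X₁ S.- Γ.X₂) ⊛ f) (2 ℕ.+ n) ≈ ι (+ 2) * elem x 2 * f n
    S₂-coefficient f n = trans (⊛-cong {g = f} X₁²-X₂≐ (λ _ → refl) (2 ℕ.+ n))
      (trans (shift-⊛ (shift (const (ι (+ 2) * elem x 2))) f (2 ℕ.+ n)) (shift-const-⊛ (ι (+ 2) * elem x 2) f (suc n)))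

-- Proper colourings of a twinned cycle as words

Walk : ∀ {N k} → (a b c : Fin N) → Vec (Fin N) k → Set
Walk a b c []      = a ≢ c × b ≢ c
Walk a b c (d ∷ w) = c ≢ d × Walk a b d w

walk? : ∀ {N k} (a b c : Fin N) (w : Vec (Fin N) k) → Dec (Walk a b c w)
walk? a b c []      = outside? a b c
walk? a b c (d ∷ w) = ¬? (c Fin.≟ d) ×-dec walk? a b d w

-- The letter `a` is the colour of the twin, `b` that of vertex 0, and `c ∷ w` lists the colours of
-- the vertices 1, 2, ... of the cycle.
TwinWalk : ∀ {N k} → (a b c : Fin N) → Vec (Fin N) k → Set
TwinWalk a b c w = a ≢ b × (a ≢ c × b ≢ c) × Walk a b c w

twinWalk? : ∀ {N k} (a b c : Fin N) (w : Vec (Fin N) k) → Dec (TwinWalk a b c w)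
twinWalk? a b c w = ¬? (a Fin.≟ b) ×-dec (outside? a b c ×-dec walk? a b c w)

module _ {N} (a b : Fin N) where

  walk-intro : ∀ {k} c (w : Vec (Fin N) k) →
    (∀ u v → toℕ v ≡ suc (toℕ u) → lookup (c ∷ w) u ≢ lookup (c ∷ w) v) →
    (∀ u → toℕ u ≡ k → a ≢ lookup (c ∷ w) u × b ≢ lookup (c ∷ w) u) →
    Walk a b c w
  walk-intro c []      step end = end zero ≡.refl
  walk-intro c (d ∷ w) step end =
    step zero (suc zero) ≡.refl ,
    walk-intro d w (λ u v v≡ → step (suc u) (suc v) (≡.cong suc v≡)) (λ u u≡ → end (suc u) (≡.cong suc u≡))

  walk-step : ∀ {k} c (w : Vec (Fin N) k) → Walk a b c w →
    ∀ u v → toℕ v ≡ suc (toℕ u) → lookup (c ∷ w) u ≢ lookup (c ∷ w) v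
  walk-step c (d ∷ w) (c≢d , W) zero    (suc zero) v≡ = c≢d
  walk-step c (d ∷ w) (c≢d , W) (suc u) (suc v)    v≡ = walk-step d w W u v (ℕ.suc-injective v≡)

  walk-end : ∀ {k} c (w : Vec (Fin N) k) → Walk a b c w →
    ∀ u → toℕ u ≡ k → a ≢ lookup (c ∷ w) u × b ≢ lookup (c ∷ w) u
  walk-end c []      W       zero    u≡ = W
  walk-end c (d ∷ w) (_ , W) (suc u) u≡ = walk-end d w W u (ℕ.suc-injective u≡)

module _ {N m} (a b c : Fin N) (w : Vec (Fin N) m) where

  private
    κ : Vec (Fin N) (3 ℕ.+ m)
    κ = a ∷ b ∷ c ∷ w

  -- Vertex 0 has the neighbours 1 and 1 + m, which coincide when m = 0, and the twin shares them.
  -- Hence both end letters of `c ∷ w` must avoid `a` and `b`.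
  proper⇒twinWalk : Proper (twin (cycle (2 ℕ.+ m)) zero) κ → TwinWalk a b c w
  proper⇒twinWalk P =
    P zero (suc zero) (inj₁ ≡.refl) ,
    (P zero (suc (suc zero)) (inj₂ ((λ ()) , inj₁ (inj₁ ≡.refl))) ,
     P (suc zero) (suc (suc zero)) ((λ ()) , inj₁ (inj₁ ≡.refl))) ,
    walk-intro a b c w
      (λ u v v≡ → P (suc (suc u)) (suc (suc v))
        ((λ u≡v → ℕ.m≢1+m+n (toℕ u) (≡.trans (≡.cong toℕ (Fin.suc-injective u≡v)) (≡.trans v≡ (≡.cong suc (≡.sym (ℕ.+-identityʳ _)))))) ,
         inj₁ (inj₁ (≡.cong suc v≡))))
      (λ u u≡ → P zero (suc (suc u)) (inj₂ ((λ ()) , inj₂ (inj₂ (≡.cong (2 ℕ.+_) u≡ , ≡.refl)))) ,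
                P (suc zero) (suc (suc u)) ((λ ()) , inj₂ (inj₂ (≡.cong (2 ℕ.+_) u≡ , ≡.refl))))

  twinWalk⇒proper : TwinWalk a b c w → Proper (twin (cycle (2 ℕ.+ m)) zero) κ
  twinWalk⇒proper (a≢b , (a≢c , b≢c) , W) = proper
    where
    from-a : ∀ u → u ≡ zero ⊎ Adj (cycle (2 ℕ.+ m)) zero u → a ≢ lookup (b ∷ c ∷ w) u
    from-a zero          _ = a≢b
    from-a (suc zero)    (inj₂ (_ , inj₁ _)) = a≢c
    from-a (suc (suc u)) (inj₂ (_ , inj₁ (inj₁ ())))
    from-a (suc (suc u)) (inj₂ (_ , inj₁ (inj₂ ())))
    from-a (suc u)       (inj₂ (_ , inj₂ (inj₂ (u≡ , _)))) =
      proj₁ (walk-end a b c w W u (ℕ.suc-injective (ℕ.suc-injective u≡)))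

    along : ∀ u v → Next u v → lookup (b ∷ c ∷ w) u ≢ lookup (b ∷ c ∷ w) v
    along zero    (suc zero) (inj₁ v≡) = b≢c
    along (suc u) (suc v)    (inj₁ v≡) = walk-step a b c w W u v (ℕ.suc-injective v≡)
    along (suc u) zero       (inj₂ (u≡ , _)) = proj₂ (walk-end a b c w W u (ℕ.suc-injective (ℕ.suc-injective u≡))) ∘ ≡.sym

    proper : Proper (twin (cycle (2 ℕ.+ m)) zero) κ
    proper zero    (suc v) adj = from-a v adj
    proper (suc u) zero    adj = from-a u adj ∘ ≡.sym
    proper (suc u) (suc v) (_ , inj₁ next) = along u v next
    proper (suc u) (suc v) (_ , inj₂ next) = along v u next ∘ ≡.sym

-- Rotation symmetry of the cycle

rotate : ∀ {n} → Fin (suc n) → Fin (suc n)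
rotate u with view u
... | ‵fromℕ          = zero
... | ‵inj₁ {i = u′} _ = suc u′

rotate-fromℕ : ∀ n → rotate (fromℕ n) ≡ zero
rotate-fromℕ n rewrite view-fromℕ n = ≡.refl

rotate-inject₁ : ∀ {n} (i : Fin n) → rotate (inject₁ i) ≡ suc i
rotate-inject₁ i rewrite view-inject₁ i = ≡.refl

rotate-surjective : ∀ {n} (u : Fin (suc n)) → ∃ λ u′ → rotate u′ ≡ u
rotate-surjective {n} zero    = fromℕ n , rotate-fromℕ n
rotate-surjective     (suc u) = inject₁ u , rotate-inject₁ u

rotate-injective : ∀ {n} (u v : Fin (suc n)) → rotate u ≡ rotate v → u ≡ v
rotate-injective u v eq with view u | view v
rotate-injective _ _ eq     | ‵fromℕ  | ‵fromℕ  = ≡.refl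
rotate-injective _ _ ≡.refl | ‵inj₁ _ | ‵inj₁ _ = ≡.refl

private
  inject₁≢n : ∀ {n} (i : Fin n) → toℕ (inject₁ i) ≢ n
  inject₁≢n i i≡ = ℕ.<⇒≢ (Fin.toℕ<n i) (≡.trans (≡.sym (Fin.toℕ-inject₁ i)) i≡)

  inject₁≢1+n : ∀ {n} (i : Fin n) → toℕ (inject₁ i) ≢ suc (toℕ (fromℕ n))
  inject₁≢1+n {n} i i≡ = ℕ.<⇒≢ (ℕ.m<n⇒m<1+n (Fin.toℕ<n i))
    (≡.trans (≡.sym (Fin.toℕ-inject₁ i)) (≡.trans i≡ (≡.cong suc (Fin.toℕ-fromℕ n))))

-- The wrap-around step out of the last vertex becomes the ordinary step from 0 to 1, and the
-- ordinary step into the last vertex becomes the wrap-around. Both ends can be the last vertex only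
-- on the one-vertex cycle.
next-rotate : ∀ {n} (u v : Fin (suc n)) → Next u v → Next (rotate u) (rotate v)
next-rotate u v next with view u | view v
next-rotate _ _ (inj₁ v≡)       | ‵fromℕ | ‵fromℕ = contradiction (≡.sym v≡) ℕ.1+n≢n
next-rotate {n} _ _ (inj₂ (_ , v≡)) | ‵fromℕ | ‵fromℕ =
  inj₂ (≡.cong suc (≡.trans (≡.sym v≡) (Fin.toℕ-fromℕ n)) , ≡.refl)
next-rotate _ _ (inj₁ v≡)       | ‵fromℕ | ‵inj₁ {i = v′} _ = contradiction v≡ (inject₁≢1+n v′)
next-rotate _ _ (inj₂ (_ , v≡)) | ‵fromℕ | ‵inj₁ {i = v′} _ =
  inj₁ (≡.cong suc (≡.trans (≡.sym (Fin.toℕ-inject₁ v′)) v≡))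
next-rotate {n} _ _ (inj₁ v≡)   | ‵inj₁ {i = u′} _ | ‵fromℕ =
  inj₂ (≡.cong suc (≡.trans (≡.sym (≡.cong suc (Fin.toℕ-inject₁ u′))) (≡.trans (≡.sym v≡) (Fin.toℕ-fromℕ n))) , ≡.refl)
next-rotate _ _ (inj₂ (u≡ , _)) | ‵inj₁ {i = u′} _ | ‵fromℕ = contradiction (ℕ.suc-injective u≡) (inject₁≢n u′)
next-rotate _ _ (inj₁ v≡)       | ‵inj₁ {i = u′} _ | ‵inj₁ {i = v′} _ =
  inj₁ (≡.cong suc (≡.trans (≡.sym (Fin.toℕ-inject₁ v′)) (≡.trans v≡ (≡.cong suc (Fin.toℕ-inject₁ u′)))))
next-rotate _ _ (inj₂ (u≡ , _)) | ‵inj₁ {i = u′} _ | ‵inj₁ _ = contradiction (ℕ.suc-injective u≡) (inject₁≢n u′)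

next-unrotate : ∀ {n} (u v : Fin (suc n)) → Next (rotate u) (rotate v) → Next u v
next-unrotate u v next with view u | view v
next-unrotate {n} _ _ (inj₂ (1≡ , _)) | ‵fromℕ | ‵fromℕ =
  inj₂ (≡.cong suc (Fin.toℕ-fromℕ n) , ≡.trans (Fin.toℕ-fromℕ n) (≡.sym (ℕ.suc-injective 1≡)))
next-unrotate {n} _ _ (inj₁ v≡)       | ‵fromℕ | ‵inj₁ {i = v′} _ =
  inj₂ (≡.cong suc (Fin.toℕ-fromℕ n) , ≡.trans (Fin.toℕ-inject₁ v′) (ℕ.suc-injective v≡))
next-unrotate {n} _ _ (inj₂ (u≡ , _)) | ‵inj₁ {i = u′} _ | ‵fromℕ =
  inj₁ (≡.trans (Fin.toℕ-fromℕ n) (≡.trans (≡.sym (ℕ.suc-injective u≡)) (≡.cong suc (≡.sym (Fin.toℕ-inject₁ u′)))))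
next-unrotate _ _ (inj₁ v≡)           | ‵inj₁ {i = u′} _ | ‵inj₁ {i = v′} _ =
  inj₁ (≡.trans (Fin.toℕ-inject₁ v′) (≡.trans (ℕ.suc-injective v≡) (≡.cong suc (≡.sym (Fin.toℕ-inject₁ u′)))))

adj-rotate : ∀ {n} (u v : Fin (suc n)) → Adj (cycle (suc n)) u v → Adj (cycle (suc n)) (rotate u) (rotate v)
adj-rotate u v (u≢v , next) = u≢v ∘ rotate-injective u v , Sum.map (next-rotate u v) (next-rotate v u) next

adj-unrotate : ∀ {n} (u v : Fin (suc n)) → Adj (cycle (suc n)) (rotate u) (rotate v) → Adj (cycle (suc n)) u v
adj-unrotate u v (u≢v , next) = u≢v ∘ ≡.cong rotate , Sum.map (next-unrotate u v) (next-unrotate v u) next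

-- Rotating the vertices corresponds to moving the last colour of the list to the front.
lookup-rotate : ∀ {A : Set} {n} (c : A) (cs : Vec A n) u → lookup (cs ∷ʳ c) u ≡ lookup (c ∷ cs) (rotate u)
lookup-rotate c cs u with view u
... | ‵fromℕ           = lookup-last cs
  where
  lookup-last : ∀ {n} (cs : Vec _ n) → lookup (cs ∷ʳ c) (fromℕ n) ≡ c
  lookup-last []       = ≡.refl
  lookup-last (_ ∷ cs) = lookup-last cs
... | ‵inj₁ {i = u′} _ = lookup-init cs u′
  where
  lookup-init : ∀ {n} (cs : Vec _ n) i → lookup (cs ∷ʳ c) (inject₁ i) ≡ lookup cs i
  lookup-init (_ ∷ cs) zero    = ≡.refl
  lookup-init (_ ∷ cs) (suc i) = lookup-init cs i

module _ {n} (v : Fin n) where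
  private
    G₀ G₁ : Graph (2 ℕ.+ n)
    G₀ = twin (cycle (suc n)) (inject₁ v)
    G₁ = twin (cycle (suc n)) (suc v)

    ρ : Fin (2 ℕ.+ n) → Fin (2 ℕ.+ n)
    ρ zero    = zero
    ρ (suc u) = suc (rotate u)

    ρ-surjective : ∀ u → ∃ λ u′ → ρ u′ ≡ u
    ρ-surjective zero    = zero , ≡.refl
    ρ-surjective (suc u) = Product.map suc (≡.cong suc) (rotate-surjective u)

    closed-rotate : ∀ u → u ≡ inject₁ v ⊎ Adj (cycle (suc n)) (inject₁ v) u →
                          rotate u ≡ suc v ⊎ Adj (cycle (suc n)) (suc v) (rotate u)
    closed-rotate u (inj₁ ≡.refl) = inj₁ (rotate-inject₁ v)
    closed-rotate u (inj₂ adj)    =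
      inj₂ (≡.subst (λ i → Adj (cycle (suc n)) i (rotate u)) (rotate-inject₁ v) (adj-rotate (inject₁ v) u adj))

    closed-unrotate : ∀ u → rotate u ≡ suc v ⊎ Adj (cycle (suc n)) (suc v) (rotate u) →
                            u ≡ inject₁ v ⊎ Adj (cycle (suc n)) (inject₁ v) u
    closed-unrotate u (inj₁ eq)  = inj₁ (rotate-injective u (inject₁ v) (≡.trans eq (≡.sym (rotate-inject₁ v))))
    closed-unrotate u (inj₂ adj) =
      inj₂ (adj-unrotate (inject₁ v) u (≡.subst (λ i → Adj (cycle (suc n)) i (rotate u)) (≡.sym (rotate-inject₁ v)) adj))

    twin-rotate : ∀ u w → Adj G₀ u w → Adj G₁ (ρ u) (ρ w)
    twin-rotate zero    (suc w) = closed-rotate w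
    twin-rotate (suc u) zero    = closed-rotate u
    twin-rotate (suc u) (suc w) = adj-rotate u w

    twin-unrotate : ∀ u w → Adj G₁ (ρ u) (ρ w) → Adj G₀ u w
    twin-unrotate zero    (suc w) = closed-unrotate w
    twin-unrotate (suc u) zero    = closed-unrotate u
    twin-unrotate (suc u) (suc w) = adj-unrotate u w

  module _ {N} (a c : Fin N) (cs : Vec (Fin N) n) where
    private
      lookup-ρ : ∀ u → lookup (a ∷ (cs ∷ʳ c)) u ≡ lookup (a ∷ c ∷ cs) (ρ u)
      lookup-ρ zero    = ≡.refl
      lookup-ρ (suc u) = lookup-rotate c cs u

    proper-rotate : Proper G₁ (a ∷ c ∷ cs) → Proper G₀ (a ∷ (cs ∷ʳ c))
    proper-rotate P u w adj eq =
      P (ρ u) (ρ w) (twin-rotate u w adj) (≡.trans (≡.sym (lookup-ρ u)) (≡.trans eq (lookup-ρ w)))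

    proper-unrotate : Proper G₀ (a ∷ (cs ∷ʳ c)) → Proper G₁ (a ∷ c ∷ cs)
    -- Properness is known at vertices pulled back along `ρ`, so preimages of both endpoints are
    -- needed.
    proper-unrotate P u w adj eq with ρ-surjective u | ρ-surjective w
    ... | u′ , ≡.refl | w′ , ≡.refl =
      P u′ w′ (twin-unrotate u′ w′ adj) (≡.trans (lookup-ρ u′) (≡.trans eq (≡.sym (lookup-ρ w′))))

-- Chromatic sums with values in a ring

module ColouringSums {c ℓ} (R : CommutativeRing c ℓ) {N : ℕ} (x : Fin N → CommutativeRing.Carrier R) where
  open CommutativeRing R hiding (zero)
  open Integers R
  open Solver using (solve; con; _:+_; _:*_; _:-_; _:=_)
  open Sums R
  open GeneratingFunctions R using (elem; elem-2)
  open TwinnedCycles R x using (G; H)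
  open SetoidReasoning setoid

  mon : ∀ {n} → Vec (Fin N) n → Carrier
  mon []      = 1#
  mon (i ∷ w) = x i * mon w

  mon-∷ʳ : ∀ {n} i (w : Vec (Fin N) n) → mon (w ∷ʳ i) ≈ x i * mon w
  mon-∷ʳ i []      = refl
  mon-∷ʳ i (j ∷ w) =
    trans (*-congˡ (mon-∷ʳ i w)) (solve 3 (λ u v w → u :* (v :* w) := v :* (u :* w)) refl (x j) (x i) (mon w))

  -- The chromatic symmetric polynomial in N variables, evaluated at the ring elements `x`.
  χ : ∀ {n} → Graph n → Carrier
  χ {n} G = sumV n (λ κ → ind (proper? G κ) * mon κ)

  -- The twin keeps its colour in front while the colours of the cycle are rotated. This is a
  -- bijection of proper colourings that preserves the monomial, since only the order of the factors
  -- changes.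
  χ-rotate : ∀ {n} (v : Fin n) → χ (twin (cycle (suc n)) (suc v)) ≈ χ (twin (cycle (suc n)) (inject₁ v))
  χ-rotate {n} v = sum-cong-≋ (λ a → begin
    sum (λ c → sumV n (λ cs → ind (proper? G₁ (a ∷ c ∷ cs)) * mon (a ∷ c ∷ cs)))
      ≈⟨ sum-cong-≋ (λ c → sumV-cong n (λ cs → *-cong
           (ind-cong (proper? G₁ (a ∷ c ∷ cs)) (proper? G₀ (a ∷ (cs ∷ʳ c))) (proper-rotate v a c cs) (proper-unrotate v a c cs))
           (*-congˡ (sym (mon-∷ʳ c cs))))) ⟩
    sum (λ c → sumV n (λ cs → ind (proper? G₀ (a ∷ (cs ∷ʳ c))) * mon (a ∷ (cs ∷ʳ c))))
      ≈⟨ sumV-∷ʳ n (λ κ → ind (proper? G₀ (a ∷ κ)) * mon (a ∷ κ)) ⟨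
    sumV (suc n) (λ κ → ind (proper? G₀ (a ∷ κ)) * mon (a ∷ κ))
      ∎)
    where
    G₀ G₁ : Graph (2 ℕ.+ n)
    G₀ = twin (cycle (suc n)) (inject₁ v)
    G₁ = twin (cycle (suc n)) (suc v)

  χ-vertex : ∀ {n} (v : Fin (suc n)) → χ (twin (cycle (suc n)) v) ≈ χ (twin (cycle (suc n)) zero)
  -- The recursive call is at `inject₁ v`, which is not a subterm of `suc v`; hence the induction on
  -- its numerical value.
  χ-vertex {n} v = go (toℕ v) v ≡.refl
    where
    go : ∀ k (v : Fin (suc n)) → toℕ v ≡ k → χ (twin (cycle (suc n)) v) ≈ χ (twin (cycle (suc n)) zero)
    go k       zero    _  = refl
    go (suc k) (suc v) v≡ =
      trans (χ-rotate v) (go k (inject₁ v) (≡.trans (Fin.toℕ-inject₁ v) (ℕ.suc-injective v≡)))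

  -- In the inductive step, `sum G - G i` is the sum over all second letters j ≠ i.
  G-walks : ∀ a b m i → G a b i (suc m) ≈ sumV m (λ w → ind (walk? a b i w) * mon (i ∷ w))
  G-walks a b zero i = begin
    x i * (t + (sum {N} (λ _ → 0#) - 0#))   ≈⟨ *-congˡ (+-congˡ (+-congʳ (sum-zero {N} (λ _ → refl)))) ⟩
    x i * (t + (0# - 0#))                   ≈⟨ solve 2 (λ x t → x :* (t :+ (con (+ 0) :- con (+ 0))) := t :* (x :* con (+ 1))) refl (x i) t ⟩
    t * (x i * 1#)                          ∎
    where
    t : Carrier
    t = ind (outside? a b i)
  G-walks a b (suc m) i = begin
    x i * (0# + (sum (λ j → G a b j (suc m)) - G a b i (suc m)))
      ≈⟨ *-congˡ (trans (+-identityˡ _) (sym (sum-≢ i (λ j → G a b j (suc m))))) ⟩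
    x i * sum (λ j → ind (¬? (i Fin.≟ j)) * G a b j (suc m))
      ≈⟨ sum-scale (x i) (λ j → ind (¬? (i Fin.≟ j)) * G a b j (suc m)) ⟨
    sum (λ j → x i * (ind (¬? (i Fin.≟ j)) * G a b j (suc m)))
      ≈⟨ sum-cong-≋ (λ j → trans (sym (*-assoc _ _ _)) (trans (*-congˡ (G-walks a b m j))
           (sym (sumV-scale m (x i * ind (¬? (i Fin.≟ j))) (λ w → ind (walk? a b j w) * mon (j ∷ w)))))) ⟩
    sum (λ j → sumV m (λ w → x i * ind (¬? (i Fin.≟ j)) * (ind (walk? a b j w) * mon (j ∷ w))))
      ≈⟨ sum-cong-≋ (λ j → sumV-cong m (λ w → trans
           (solve 4 (λ x u v m → x :* u :* (v :* m) := u :* v :* (x :* m)) refl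
             (x i) (ind (¬? (i Fin.≟ j))) (ind (walk? a b j w)) (mon (j ∷ w)))
           (*-congʳ (sym (ind-× (¬? (i Fin.≟ j)) (walk? a b j w)))))) ⟩
    sum (λ j → sumV m (λ w → ind (walk? a b i (j ∷ w)) * mon (i ∷ j ∷ w)))
      ∎

  χ≈H : ∀ m → χ (twin (cycle (2 ℕ.+ m)) zero) ≈ H m
  χ≈H m = sum-cong-≋ (λ a → sum-cong-≋ (λ b → begin
    sum (λ i → sumV m (λ w → ind (proper? (twin (cycle (2 ℕ.+ m)) zero) (a ∷ b ∷ i ∷ w)) * mon (a ∷ b ∷ i ∷ w)))
      ≈⟨ sum-cong-≋ (λ i → sumV-cong m (λ w → step a b i w)) ⟩
    sum (λ i → sumV m (λ w → r a b * ind (outside? a b i) * (ind (walk? a b i w) * mon (i ∷ w))))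
      ≈⟨ sum-cong-≋ (λ i → trans (sumV-scale m (r a b * ind (outside? a b i)) (λ w → ind (walk? a b i w) * mon (i ∷ w)))
           (trans (*-congˡ (sym (G-walks a b m i))) (*-assoc _ _ _))) ⟩
    sum (λ i → r a b * (ind (outside? a b i) * G a b i (suc m)))
      ≈⟨ sum-scale (r a b) (λ i → ind (outside? a b i) * G a b i (suc m)) ⟩
    r a b * sum (λ i → ind (outside? a b i) * G a b i (suc m))
      ≈⟨ trans (*-assoc _ _ _) (*-congˡ (*-assoc _ _ _)) ⟩
    ind (¬? (a Fin.≟ b)) * (x a * (x b * sum (λ i → ind (outside? a b i) * G a b i (suc m))))
      ∎))
    where
    r : Fin N → Fin N → Carrier
    r a b = ind (¬? (a Fin.≟ b)) * (x a * x b)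

    step : ∀ a b i w → ind (proper? (twin (cycle (2 ℕ.+ m)) zero) (a ∷ b ∷ i ∷ w)) * mon (a ∷ b ∷ i ∷ w) ≈
                       r a b * ind (outside? a b i) * (ind (walk? a b i w) * mon (i ∷ w))
    step a b i w = trans
      (*-congʳ (trans
        (ind-cong (proper? (twin (cycle (2 ℕ.+ m)) zero) (a ∷ b ∷ i ∷ w)) (twinWalk? a b i w)
          (proper⇒twinWalk a b i w) (twinWalk⇒proper a b i w))
        (trans (ind-× (¬? (a Fin.≟ b)) (outside? a b i ×-dec walk? a b i w))
          (*-congˡ (ind-× (outside? a b i) (walk? a b i w))))))
      (solve 6 (λ u v w x y m → u :* (v :* w) :* (x :* (y :* m)) := u :* (x :* y) :* v :* (w :* m)) refl
        (ind (¬? (a Fin.≟ b))) (ind (outside? a b i)) (ind (walk? a b i w)) (x a) (x b) (mon (i ∷ w)))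

  -- The cycle on one vertex lies outside the range of `H`. Its twin is an edge, so the sum runs
  -- over ordered pairs of distinct colours.
  χ-edge : χ (twin (cycle 1) zero) ≈ ι (+ 2) * elem x 2
  χ-edge = begin
    sum (λ a → sum (λ b → ind (proper? (twin (cycle 1) zero) (a ∷ b ∷ [])) * (x a * (x b * 1#))))
      ≈⟨ sum-cong-≋ (λ a → sum-cong-≋ (λ b → *-cong
           (ind-cong (proper? (twin (cycle 1) zero) (a ∷ b ∷ [])) (¬? (a Fin.≟ b)) (λ P → P zero (suc zero) (inj₁ ≡.refl)) (proper a b))
           (*-congˡ (*-identityʳ (x b))))) ⟩
    sum (λ a → sum (λ b → ind (¬? (a Fin.≟ b)) * (x a * x b)))
      ≈⟨ sum-off-diagonal (λ a b → x a * x b) ⟩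
    sum (λ a → sum (λ b → x a * x b)) - sum (λ a → x a * x a)
      ≈⟨ +-congʳ (sum-product x x) ⟩
    sum x * sum x - sum (λ a → x a * x a)
      ≈⟨ elem-2 x ⟩
    ι (+ 2) * elem x 2
      ∎
    where
    proper : ∀ a b → a ≢ b → Proper (twin (cycle 1) zero) (a ∷ b ∷ [])
    proper a b a≢b zero       (suc zero) _         = a≢b
    proper a b a≢b (suc zero) zero       _         = a≢b ∘ ≡.sym
    proper a b a≢b (suc zero) (suc zero) (u≢u , _) = contradiction ≡.refl u≢u

-- Transfer from coefficient functions to iterated power series

module ∑ℤ = Sums ℤ.+-*-commutativeRing

sumℤ-++ : ∀ xs ys → sumℤ (xs ++ ys) ≡ sumℤ xs ℤ.+ sumℤ ys
sumℤ-++ []       ys = ≡.sym (ℤ.+-identityˡ _)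
sumℤ-++ (x ∷ xs) ys = ≡.trans (≡.cong (λ s → x ℤ.+ s) (sumℤ-++ xs ys)) (≡.sym (ℤ.+-assoc x (sumℤ xs) (sumℤ ys)))

sumℤ-cartesianProductWith : ∀ {A B C : Set} (h : C → ℤ) (f : A → B → C) xs ys →
  sumℤ (map h (cartesianProductWith f xs ys)) ≡ sumℤ (map (λ x → sumℤ (map (λ y → h (f x y)) ys)) xs)
sumℤ-cartesianProductWith h f []       ys = ≡.refl
sumℤ-cartesianProductWith h f (x ∷ xs) ys = begin
  sumℤ (map h (map (f x) ys ++ cartesianProductWith f xs ys))
    ≡⟨ ≡.cong sumℤ (List.map-++ h (map (f x) ys) _) ⟩
  sumℤ (map h (map (f x) ys) ++ map h (cartesianProductWith f xs ys))
    ≡⟨ sumℤ-++ (map h (map (f x) ys)) _ ⟩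
  sumℤ (map h (map (f x) ys)) ℤ.+ sumℤ (map h (cartesianProductWith f xs ys))
    ≡⟨ ≡.cong₂ ℤ._+_ (≡.cong sumℤ (≡.sym (List.map-∘ ys))) (sumℤ-cartesianProductWith h f xs ys) ⟩
  sumℤ (map (λ y → h (f x y)) ys) ℤ.+ sumℤ (map (λ x → sumℤ (map (λ y → h (f x y)) ys)) xs)
    ∎
  where
  open ≡.≡-Reasoning

sumℤ-allFin : ∀ {n} (f : Fin n → ℤ) → sumℤ (map f (allFin n)) ≡ ∑ℤ.sum f
sumℤ-allFin f = ≡.trans (≡.cong sumℤ (List.map-tabulate id f)) (sumℤ-tabulate f)
  where
  sumℤ-tabulate : ∀ {n} (f : Fin n → ℤ) → sumℤ (List.tabulate f) ≡ ∑ℤ.sum f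
  sumℤ-tabulate {zero}  f = ≡.refl
  sumℤ-tabulate {suc n} f = ≡.cong (λ s → f zero ℤ.+ s) (sumℤ-tabulate (f ∘ suc))

sumℤ-colourings : ∀ n N (f : Colouring n N → ℤ) → sumℤ (map f (colourings n N)) ≡ ∑ℤ.sumV n f
sumℤ-colourings zero    N f = ℤ.+-identityʳ (f [])
sumℤ-colourings (suc n) N f = ≡.trans (sumℤ-cartesianProductWith f _∷_ (allFin N) (colourings n N))
  (≡.trans (sumℤ-allFin (λ i → sumℤ (map (λ κ → f (i ∷ κ)) (colourings n N))))
    (∑ℤ.sum-cong-≋ (λ i → sumℤ-colourings n N (λ κ → f (i ∷ κ)))))

length-filter : ∀ {A : Set} {P : A → Set} (P? : ∀ x → Dec (P x)) xs →
  + length (filter P? xs) ≡ sumℤ (map (λ x → ∑ℤ.ind (P? x)) xs)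
length-filter P? []       = ≡.refl
length-filter P? (x ∷ xs) with does (P? x)
... | true  = ≡.cong ℤ.suc (length-filter P? xs)
... | false = ≡.trans (length-filter P? xs) (≡.sym (ℤ.+-identityˡ _))

-- The outermost power series variable is the first entry of an exponent vector.
ℤ[[_]] : ℕ → CommutativeRing 0ℓ 0ℓ
ℤ[[ zero  ]] = ℤ.+-*-commutativeRing
ℤ[[ suc N ]] = PowerSeries.R[[z]] ℤ[[ N ]]

module R (N : ℕ) where
  open CommutativeRing ℤ[[ N ]] public hiding (zero)
  open Integers ℤ[[ N ]] public
  open Sums ℤ[[ N ]] public
  open PowerSeries ℤ[[ N ]] public using (_⊛_; ⊛-cong)

-- Identifies coefficient functions with elements of a commutative ring. Identities are proved there
-- and brought back by `curry-injective`.
curry : ∀ N → (Monomial N → ℤ) → R.Carrier N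
curry zero    f   = f []
curry (suc N) f a = curry N (λ α → f (a ∷ α))

curry-cong : ∀ N {f g : Monomial N → ℤ} → (∀ α → f α ≡ g α) → R._≈_ N (curry N f) (curry N g)
curry-cong zero    f≡g   = f≡g []
curry-cong (suc N) f≡g a = curry-cong N (λ α → f≡g (a ∷ α))

curry-injective : ∀ N {f g : Monomial N → ℤ} → R._≈_ N (curry N f) (curry N g) → ∀ α → f α ≡ g α
curry-injective zero    f≈g []      = f≈g
curry-injective (suc N) f≈g (a ∷ α) = curry-injective N (f≈g a) α

curry-+ : ∀ N (f g : Monomial N → ℤ) → R._≈_ N (curry N (λ α → f α ℤ.+ g α)) (R._+_ N (curry N f) (curry N g))
curry-+ zero    f g   = ≡.refl
curry-+ (suc N) f g a = curry-+ N (λ α → f (a ∷ α)) (λ α → g (a ∷ α))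

curry-neg : ∀ N (f : Monomial N → ℤ) → R._≈_ N (curry N (λ α → ℤ.- f α)) (R.-_ N (curry N f))
curry-neg zero    f   = ≡.refl
curry-neg (suc N) f a = curry-neg N (λ α → f (a ∷ α))

curry-0 : ∀ N → R._≈_ N (curry N (λ _ → + 0)) (R.0# N)
curry-0 zero      = ≡.refl
curry-0 (suc N) a = curry-0 N

ι-ℤ : ∀ c → Integers.ι ℤ.+-*-commutativeRing c ≡ c
ι-ℤ (+ n)    = natural-ℤ n
  where
  natural-ℤ : ∀ n → Integers.natural ℤ.+-*-commutativeRing n ≡ + n
  natural-ℤ zero          = ≡.refl
  natural-ℤ (suc zero)    = ≡.refl
  natural-ℤ (suc (suc n)) = ≡.cong ℤ.suc (natural-ℤ (suc n))
ι-ℤ -[1+ n ] = ≡.cong ℤ.-_ (ι-ℤ (+ suc n))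

curry-scale : ∀ N c (f : Monomial N → ℤ) → R._≈_ N (curry N (λ α → c ℤ.* f α)) (R._*_ N (R.ι N c) (curry N f))
curry-scale zero    c f   = ≡.cong (λ d → d ℤ.* f []) (≡.sym (ι-ℤ c))
curry-scale (suc N) c f a = R.trans N (curry-scale N c (λ α → f (a ∷ α))) (R.sym N (PowerSeries.ι-⊛ ℤ[[ N ]] c (curry (suc N) f) a))

-- Passes from sums indexed by `n ∸ i` to the peeled convolution. The terms `t i j` are given for
-- all i and j, not just for i + j = n, so that the induction can shift `t`.
curry-convolution : ∀ N (t : ℕ → ℕ → Monomial N → ℤ) (f g : ℕ → R.Carrier N) →
  (∀ i j → R._≈_ N (curry N (t i j)) (R._*_ N (f i) (g j))) → ∀ n →
  R._≈_ N (curry N (λ α → sumℤ (applyUpTo (λ i → t i (n ∸ i) α) (suc n)))) (R._⊛_ N f g n)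
curry-convolution N t f g t≈ zero    = R.trans N (curry-cong N (λ α → ℤ.+-identityʳ (t 0 0 α))) (t≈ 0 0)
curry-convolution N t f g t≈ (suc n) = R.trans N (curry-+ N (t 0 (suc n)) _)
  (R.+-cong N (t≈ 0 (suc n)) (curry-convolution N (t ∘ suc) (f ∘ suc) g (t≈ ∘ suc) n))

product : ∀ {N} → (Monomial N → ℤ) → (Monomial N → ℤ) → Monomial N → ℤ
product f g α = sumℤ (map (λ (β , γ) → f β ℤ.* g γ) (factorisations α))

-- Induction on the number of variables: factorising the first exponent is a convolution, and its
-- terms are products in the remaining variables.
curry-product : ∀ N (f g : Monomial N → ℤ) → R._≈_ N (curry N (product f g)) (R._*_ N (curry N f) (curry N g))
curry-product zero    f g   = ℤ.+-identityʳ _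
curry-product (suc N) f g a = R.trans N
  (curry-cong N (λ α → ≡.trans
    (sumℤ-cartesianProductWith (λ (β , γ) → f β ℤ.* g γ) (λ i (β , γ) → (i ∷ β) , ((a ∸ i) ∷ γ)) (upTo (suc a)) (factorisations α))
    (≡.cong sumℤ (List.map-upTo (λ i → product (λ β → f (i ∷ β)) (λ γ → g ((a ∸ i) ∷ γ)) α) (suc a)))))
  (curry-convolution N (λ i j → product (λ β → f (i ∷ β)) (λ γ → g (j ∷ γ))) (curry (suc N) f) (curry (suc N) g)
    (λ i j → curry-product N (λ β → f (i ∷ β)) (λ γ → g (j ∷ γ))) a)

curry-sum : ∀ N {n} (f : Fin n → Monomial N → ℤ) →
  R._≈_ N (curry N (λ α → ∑ℤ.sum (λ i → f i α))) (R.sum N (λ i → curry N (f i)))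
curry-sum N {zero}  f = curry-0 N
curry-sum N {suc n} f = R.trans N (curry-+ N (f zero) (λ α → ∑ℤ.sum (λ i → f (suc i) α)))
  (R.+-congˡ N (curry-sum N (f ∘ suc)))

curry-sumV : ∀ N {M} n (f : Vec (Fin M) n → Monomial N → ℤ) →
  R._≈_ N (curry N (λ α → ∑ℤ.sumV n (λ κ → f κ α))) (R.sumV N n (λ κ → curry N (f κ)))
curry-sumV N zero    f = R.refl N
curry-sumV N (suc n) f = R.trans N (curry-sum N (λ i α → ∑ℤ.sumV n (λ κ → f (i ∷ κ) α)))
  (R.sum-cong-≋ N (λ i → curry-sumV N n (λ κ → f (i ∷ κ))))

vars : ∀ N → Fin N → R.Carrier N
vars (suc N) zero    = PowerSeries.shift ℤ[[ N ]] (PowerSeries.const ℤ[[ N ]] (R.1# N))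
vars (suc N) (suc i) = PowerSeries.const ℤ[[ N ]] (vars N i)

module _ {c ℓ} (A : CommutativeRing c ℓ) where
  open CommutativeRing A hiding (zero)
  open PowerSeries A
  private
    module S = CommutativeRing R[[z]]
    module E  = GeneratingFunctions A
    module ES = GeneratingFunctions R[[z]]

  -- In the ring with one more variable the old variables are constants, so their elementary
  -- symmetric functions are constants too.
  elem-const : ∀ {N} (x : Fin N → Carrier) k → ES.elem (const ∘ x) k ≐ const (E.elem x k)
  elem-const {zero}  x zero    = λ _ → refl
  elem-const {zero}  x (suc k) = const-0
    where
    const-0 : (λ _ → 0#) ≐ const 0#
    const-0 zero    = refl
    const-0 (suc _) = refl
  elem-const {suc N} x zero    = S.trans (S.+-identityʳ _) (S.trans (elem-const (x ∘ suc) zero) const-+0)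
    where
    const-+0 : const (E.elem (x ∘ suc) 0) ≐ const (E.elem (x ∘ suc) 0 + 0#)
    const-+0 zero    = sym (+-identityʳ _)
    const-+0 (suc _) = refl
  elem-const {suc N} x (suc k) = S.trans
    (S.+-cong (elem-const (x ∘ suc) (suc k))
      (S.trans (S.*-congˡ {const (x zero)} (elem-const (x ∘ suc) k)) (const-⊛ (x zero) (const (E.elem (x ∘ suc) k)))))
    const-+
    where
    const-+ : (λ n → const (E.elem (x ∘ suc) (suc k)) n + x zero * const (E.elem (x ∘ suc) k) n) ≐ const (E.elem x (suc k))
    const-+ zero    = refl
    const-+ (suc _) = trans (+-identityˡ _) (zeroʳ _)

if-∧-false : ∀ (b : Bool) {A : Set} {x y : A} → (if b ∧ false then x else y) ≡ y
if-∧-false true  = ≡.refl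
if-∧-false false = ≡.refl

-- In the first variable, e_k is e_k of the others plus that variable times their e_(k-1). Hence the
-- three cases of exponent 0, exponent 1, and a larger exponent, where the coefficient is zero.
curry-e : ∀ N k → R._≈_ N (curry N (e k N)) (GeneratingFunctions.elem ℤ[[ N ]] (vars N) k)
curry-e zero    zero    = ≡.refl
curry-e zero    (suc k) = ≡.refl
curry-e (suc N) k = λ where
    zero          → trans (curry-e N k) (sym (trans (+-cong (elem-const ℤ[[ N ]] (vars N) k zero) (shift-0 k)) (+-identityʳ _)))
    (suc zero)    → sym (trans (+-cong (elem-const ℤ[[ N ]] (vars N) k 1) (shift-1 k)) (+-identityˡ _))
    (suc (suc a)) → trans (curry-0 N) (sym (trans (+-cong (elem-const ℤ[[ N ]] (vars N) k (2 ℕ.+ a)) (shift-2 a k)) (+-identityˡ _)))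
  where
  open CommutativeRing ℤ[[ N ]] hiding (zero)
  open PowerSeries ℤ[[ N ]]
  module PS = PowerSeries R[[z]]
  open GeneratingFunctions ℤ[[ N ]] using (elem)

  shifted : ℕ → ℕ → Carrier
  shifted = PS.shift (λ j → vars (suc N) zero ⊛ GeneratingFunctions.elem R[[z]] (const ∘ vars N) j)

  shifted-suc : ∀ k a → shifted (suc k) (suc a) ≈ const (elem (vars N) k) a
  shifted-suc k a = trans (shift-const-⊛ 1# (GeneratingFunctions.elem R[[z]] (const ∘ vars N) k) (suc a))
    (trans (*-identityˡ _) (elem-const ℤ[[ N ]] (vars N) k a))

  shift-0 : ∀ k → shifted k 0 ≈ 0#
  shift-0 zero    = refl
  shift-0 (suc k) = shift-const-⊛ 1# (GeneratingFunctions.elem R[[z]] (const ∘ vars N) k) 0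

  shift-1 : ∀ k → shifted k 1 ≈ curry N (λ α → e k (suc N) (1 ∷ α))
  shift-1 zero    = sym (trans (curry-cong N (λ α → if-∧-false (does (VecAll.all? (ℕ._≤? 1) α)))) (curry-0 N))
  shift-1 (suc k) = trans (shifted-suc k 0) (sym (curry-e N k))

  shift-2 : ∀ a k → shifted k (2 ℕ.+ a) ≈ 0#
  shift-2 a zero    = refl
  shift-2 a (suc k) = shifted-suc k (suc a)

curry-ind : ∀ N {P : Set} (d : Dec P) (f : Monomial N → ℤ) →
  R._≈_ N (curry N (λ α → ∑ℤ.ind d ℤ.* f α)) (R._*_ N (R.ind N d) (curry N f))
curry-ind N (yes _) f = R.trans N (curry-cong N (λ α → ℤ.*-identityˡ (f α))) (R.sym N (R.*-identityˡ N _))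
curry-ind N (no _)  f = R.trans N (curry-0 N) (R.sym N (R.zeroˡ N _))

monomial : ∀ {N} → Monomial N → Monomial N → ℤ
monomial β α = ∑ℤ.ind (Vec.≡-dec ℕ._≟_ β α)

monomial-∷ : ∀ N b (β : Monomial N) a →
  R._≈_ N (curry N (λ α → monomial (b ∷ β) (a ∷ α))) (R._*_ N (R.ind N (b ℕ.≟ a)) (curry N (monomial β)))
monomial-∷ N b β a = R.trans N
  (curry-cong N (λ α → ∑ℤ.ind-× (b ℕ.≟ a) (Vec.≡-dec ℕ._≟_ β α)))
  (curry-ind N (b ℕ.≟ a) (monomial β))

monomial-0 : ∀ N → R._≈_ N (curry N (monomial (tabulate (λ _ → 0)))) (R.1# N)
monomial-0 zero    = ≡.refl
monomial-0 (suc N) zero    = monomial-0 N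
monomial-0 (suc N) (suc a) = curry-0 N

-- Has the shape to which `Vec.count` reduces on a cons, so that the weight of `c ∷ κ` is by
-- definition a tabulated `bump`.
bump : ∀ {N} → Fin N → (Fin N → ℕ) → Fin N → ℕ
bump c f i = (if does (i Fin.≟ c) then suc else id) $ f i

monomial-bump : ∀ N c (f : Fin N → ℕ) →
  R._≈_ N (curry N (monomial (tabulate (bump c f)))) (R._*_ N (vars N c) (curry N (monomial (tabulate f))))
monomial-bump (suc N) zero    f = R.sym (suc N) (R.trans (suc N) (shift-const-⊛ 1# g) (λ where
    zero    → sym (curry-0 N)
    (suc a) → *-identityˡ (g a)))
  where
  open CommutativeRing ℤ[[ N ]] hiding (zero)
  open PowerSeries ℤ[[ N ]]
  g : ℕ → Carrier
  g = curry (suc N) (monomial (tabulate f))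
monomial-bump (suc N) (suc c) f a = begin
  curry N (λ α → monomial (f zero ∷ tabulate (bump c (f ∘ suc))) (a ∷ α))
    ≈⟨ monomial-∷ N (f zero) (tabulate (bump c (f ∘ suc))) a ⟩
  i * curry N (monomial (tabulate (bump c (f ∘ suc))))
    ≈⟨ *-congˡ (monomial-bump N c (f ∘ suc)) ⟩
  i * (vars N c * curry N (monomial (tabulate (f ∘ suc))))
    ≈⟨ trans (sym (*-assoc _ _ _)) (trans (*-congʳ (*-comm _ _)) (*-assoc _ _ _)) ⟩
  vars N c * (i * curry N (monomial (tabulate (f ∘ suc))))
    ≈⟨ *-congˡ (monomial-∷ N (f zero) (tabulate (f ∘ suc)) a) ⟨
  vars N c * curry (suc N) (monomial (tabulate f)) a
    ≈⟨ const-⊛ (vars N c) (curry (suc N) (monomial (tabulate f))) a ⟨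
  (const (vars N c) ⊛ curry (suc N) (monomial (tabulate f))) a
    ∎
  where
  open CommutativeRing ℤ[[ N ]] hiding (zero)
  open PowerSeries ℤ[[ N ]]
  open SetoidReasoning setoid
  i : Carrier
  i = Sums.ind ℤ[[ N ]] (f zero ℕ.≟ a)

monomial-weight : ∀ N {n} (κ : Colouring n N) →
  R._≈_ N (curry N (monomial (weight κ))) (ColouringSums.mon ℤ[[ N ]] (vars N) κ)
monomial-weight N []      = monomial-0 N
monomial-weight N (c ∷ κ) = R.trans N (monomial-bump N c (λ i → Vec.count (i Fin.≟_) κ))
  (R.*-congˡ N (monomial-weight N κ))

curry-X : ∀ N {n} (G : Graph n) → R._≈_ N (curry N (Defs.X G N)) (ColouringSums.χ ℤ[[ N ]] (vars N) G)
curry-X N {n} G = begin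
  curry N (Defs.X G N)
    ≈⟨ curry-cong N (λ α → ≡.trans (length-filter (P? α) (colourings n N)) (sumℤ-colourings n N (λ κ → ∑ℤ.ind (P? α κ)))) ⟩
  curry N (λ α → ∑ℤ.sumV n (λ κ → ∑ℤ.ind (P? α κ)))
    ≈⟨ curry-sumV N n (λ κ α → ∑ℤ.ind (P? α κ)) ⟩
  sumV n (λ κ → curry N (λ α → ∑ℤ.ind (P? α κ)))
    ≈⟨ sumV-cong n (λ κ → trans
         (curry-cong N (λ α → ∑ℤ.ind-× (proper? G κ) (Vec.≡-dec ℕ._≟_ (weight κ) α)))
         (trans (curry-ind N (proper? G κ) (monomial (weight κ))) (*-congˡ (monomial-weight N κ)))) ⟩
  ColouringSums.χ ℤ[[ N ]] (vars N) G
    ∎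
  where
  open R N
  open SetoidReasoning setoid
  P? : ∀ α κ → Dec _
  P? α κ = proper? G κ ×-dec Vec.≡-dec ℕ._≟_ (weight κ) α

-- The recurrence and the initial values

-- The coefficients of the recurrence for n = j + 5.
c₁ c₂ c₃ : ℕ → ℕ
c₁ j = 2 ℕ.* (5 ℕ.+ j ℕ.+ 1) ℕ.* (2 ℕ.* (5 ℕ.+ j) ∸ 3)
c₂ j = 2 ℕ.* (4 ℕ.+ j) ℕ.* (2 ℕ.+ j)
c₃ j = 2 ℕ.* (2 ℕ.+ j)

-- The truncated subtraction computes, because three successors are visible in 2 (5 + j). The result
-- is a polynomial in 2 + j = n - 3, the indeterminate `ν` of `H-step`.
ℕ-c₁ : ∀ j → c₁ j ≡ 2 ℕ.* (4 ℕ.+ (2 ℕ.+ j)) ℕ.* (3 ℕ.+ 2 ℕ.* (2 ℕ.+ j))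
ℕ-c₁ = solve 1 (λ j →
  con 2 :* (con 5 :+ j :+ con 1) :* (con 2 :+ j :+ (con 5 :+ j :+ con 0)) :=
  con 2 :* (con 4 :+ (con 2 :+ j)) :* (con 3 :+ con 2 :* (con 2 :+ j))) ≡.refl
  where open ℕ.+-*-Solver

sumℤ-upTo-cong : ∀ n {f g : ℕ → ℤ} → (∀ i → i ℕ.< n → f i ≡ g i) → sumℤ (applyUpTo f n) ≡ sumℤ (applyUpTo g n)
sumℤ-upTo-cong zero    f≡g = ≡.refl
sumℤ-upTo-cong (suc n) f≡g =
  ≡.cong₂ ℤ._+_ (f≡g 0 (ℕ.s≤s ℕ.z≤n)) (sumℤ-upTo-cong n (λ i i<n → f≡g (suc i) (ℕ.s≤s i<n)))

module RecurrenceTerms (v : CycleVertices) (j : ℕ) where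
  open Defs

  -- Arranged to be definitionally the four summands of the statement at n = 5 + j.
  s₁ s₂ s₃ s₄ : Series
  s₁ = ∑[ 3 ⋯ 3 ℕ.+ j ] (λ k → (+ (k ∸ 1)) · (e k * XC v ((5 ℕ.+ j) ∸ k)))
  s₂ = (+ c₁ j) · e (5 ℕ.+ j ℕ.+ 1)
  s₃ = (+ c₂ j) · (e (5 ℕ.+ j) * e 1)
  s₄ = e 2 * (XC v (3 ℕ.+ j) - (+ c₃ j) · e (4 ℕ.+ j))

module Recurrence (v : CycleVertices) (N : ℕ) where
  open R N
  open PowerSeries ℤ[[ N ]] using (tail)
  open Solver using (solve; con; :-_; _:+_; _:*_; _:-_; _:=_)
  open TwinnedCycles ℤ[[ N ]] (vars N) using (D; H; convolution)
  open GeneratingFunctions ℤ[[ N ]] using (elem-0)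
  open ColouringSums ℤ[[ N ]] (vars N) using (χ-vertex; χ≈H; χ-edge)
  open SetoidReasoning setoid
  private
    module S = CommutativeRing (PowerSeries.R[[z]] ℤ[[ N ]])

  E : ℕ → Carrier
  E = GeneratingFunctions.elem ℤ[[ N ]] (vars N)

  XC≈H : ∀ m → curry N (XC v (2 ℕ.+ m) N) ≈ H m
  XC≈H m = trans (curry-X N (twin (cycle (2 ℕ.+ m)) (v (2 ℕ.+ m)))) (trans (χ-vertex (v (2 ℕ.+ m))) (χ≈H m))

  XC₁ : curry N (XC v 1 N) ≈ ι (+ 2) * E 2
  XC₁ = trans (curry-X N (twin (cycle 1) (v 1))) (trans (χ-vertex (v 1)) χ-edge)

  D-0 : D 0 ≈ 1#
  D-0 = trans (*-congˡ (elem-0 (vars N))) (solve 0 ((con (+ 1) :- con (+ 0)) :* con (+ 1) := con (+ 1)) refl)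

  H-0 : H 0 ≈ ι (+ 6) * E 3
  H-0 = begin
    H 0          ≈⟨ *-identityˡ _ ⟨
    1# * H 0     ≈⟨ *-congʳ D-0 ⟨
    (D ⊛ H) 0    ≈⟨ convolution 0 ⟩
    _            ≈⟨ solve 3 (λ e₁ e₂ e₃ →
                      con (+ 2) :* (con (+ 3) :+ con (+ 0)) :* (con (+ 2) :* con (+ 0) :+ con (+ 1)) :* e₃
                      :+ con (+ 2) :* (con (+ 0) :+ con (+ 1)) :* (con (+ 0) :- con (+ 1)) :* (e₁ :* e₂)
                      :- con (+ 2) :* (con (+ 0) :- con (+ 1)) :* (e₂ :* e₁)
                      := con (+ 6) :* e₃) refl (E 1) (E 2) (E 3) ⟩
    ι (+ 6) * E 3 ∎

  H-1 : H 1 ≈ ι (+ 24) * E 4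
  H-1 = begin
    H 1                          ≈⟨ solve 3 (λ h g e → h := con (+ 1) :* h :+ (con (+ 1) :- con (+ 1)) :* e :* g) refl (H 1) (H 0) (E 1) ⟩
    1# * H 1 + D 1 * H 0         ≈⟨ +-congʳ (*-congʳ D-0) ⟨
    (D ⊛ H) 1                    ≈⟨ convolution 1 ⟩
    _                            ≈⟨ solve 4 (λ e₁ e₂ e₃ e₄ →
                                      con (+ 2) :* (con (+ 3) :+ con (+ 1)) :* (con (+ 2) :* con (+ 1) :+ con (+ 1)) :* e₄
                                      :+ con (+ 2) :* (con (+ 1) :+ con (+ 1)) :* (con (+ 1) :- con (+ 1)) :* (e₁ :* e₃)
                                      :- con (+ 2) :* (con (+ 1) :- con (+ 1)) :* (e₂ :* e₂)
                                      := con (+ 24) :* e₄) refl (E 1) (E 2) (E 3) (E 4) ⟩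
    ι (+ 24) * E 4               ∎

  -- The 4 is 6 - 2: the term `D 2 * H 0` contributes 6 e₂ e₃ when moved to the other side, and
  -- `convolution` contributes -2 e₂ e₃.
  H-2 : H 2 ≈ ι (+ 50) * E 5 + ι (+ 6) * (E 4 * E 1) + ι (+ 4) * (E 3 * E 2)
  H-2 = begin
    H 2
      ≈⟨ solve 5 (λ h₂ h₁ h₀ e₁ e₂ →
           h₂ := con (+ 1) :* h₂ :+ ((con (+ 1) :- con (+ 1)) :* e₁ :* h₁ :+ (con (+ 1) :- con (+ 2)) :* e₂ :* h₀) :+ e₂ :* h₀)
           refl (H 2) (H 1) (H 0) (E 1) (E 2) ⟩
    1# * H 2 + (D 1 * H 1 + D 2 * H 0) + E 2 * H 0
      ≈⟨ +-cong (+-congʳ (*-congʳ (sym D-0))) (*-congˡ H-0) ⟩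
    (D ⊛ H) 2 + E 2 * (ι (+ 6) * E 3)
      ≈⟨ +-congʳ (convolution 2) ⟩
    _
      ≈⟨ solve 5 (λ e₁ e₂ e₃ e₄ e₅ →
           con (+ 2) :* (con (+ 3) :+ con (+ 2)) :* (con (+ 2) :* con (+ 2) :+ con (+ 1)) :* e₅
           :+ con (+ 2) :* (con (+ 2) :+ con (+ 1)) :* (con (+ 2) :- con (+ 1)) :* (e₁ :* e₄)
           :- con (+ 2) :* (con (+ 2) :- con (+ 1)) :* (e₂ :* e₃)
           :+ e₂ :* (con (+ 6) :* e₃)
           := con (+ 50) :* e₅ :+ con (+ 6) :* (e₄ :* e₁) :+ con (+ 4) :* (e₃ :* e₂)) refl (E 1) (E 2) (E 3) (E 4) (E 5) ⟩
    ι (+ 50) * E 5 + ι (+ 6) * (E 4 * E 1) + ι (+ 4) * (E 3 * E 2)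
      ∎

  K : ℕ → Carrier
  K i = ι (+ (2 ℕ.+ i)) * E (3 ℕ.+ i)

  D-tail : ∀ i → D (3 ℕ.+ i) ≈ - K i
  D-tail i = trans (*-congʳ (+-congˡ (-‿cong (ι-suc (+ (2 ℕ.+ i))))))
    (solve 2 (λ k e → (con (+ 1) :- (con (+ 1) :+ k)) :* e := :- (k :* e)) refl (ι (+ (2 ℕ.+ i))) (E (3 ℕ.+ i)))

  D⊛H-tail : ∀ j → (tail (tail (tail D)) ⊛ H) j ≈ - (K ⊛ H) j
  D⊛H-tail j = trans (⊛-cong D-tail (λ _ → refl) j) (sym (RingProperties.-‿distribˡ-* S.ring K H j))

  -- The coefficients `D 0`, `D 1`, `D 2` amount to 1, 0, -e₂ and those from `D 3` on to `- K`.
  -- Solving `convolution (3 + j)` for the newest term therefore gives the recurrence.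
  H-step : ∀ j → H (3 ℕ.+ j) ≈
    (K ⊛ H) j
    + ι (+ c₁ j) * E (6 ℕ.+ j)
    + ι (+ c₂ j) * (E (5 ℕ.+ j) * E 1)
    + E 2 * (H (1 ℕ.+ j) - ι (+ c₃ j) * E (4 ℕ.+ j))
  H-step j = begin
    H (3 ℕ.+ j)
      ≈⟨ solve 6 (λ h₃ h₂ h₁ e₁ e₂ k →
           h₃ := con (+ 1) :* h₃ :+ ((con (+ 1) :- con (+ 1)) :* e₁ :* h₂ :+ ((con (+ 1) :- con (+ 2)) :* e₂ :* h₁ :+ (:- k)))
                 :+ (k :+ e₂ :* h₁))
           refl (H (3 ℕ.+ j)) (H (2 ℕ.+ j)) (H (1 ℕ.+ j)) (E 1) (E 2) ((K ⊛ H) j) ⟩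
    1# * H (3 ℕ.+ j) + (D 1 * H (2 ℕ.+ j) + (D 2 * H (1 ℕ.+ j) + - (K ⊛ H) j)) + ((K ⊛ H) j + E 2 * H (1 ℕ.+ j))
      ≈⟨ +-congʳ (+-cong (*-congʳ D-0) (+-congˡ (+-congˡ (D⊛H-tail j)))) ⟨
    (D ⊛ H) (3 ℕ.+ j) + ((K ⊛ H) j + E 2 * H (1 ℕ.+ j))
      ≈⟨ +-congʳ (convolution (3 ℕ.+ j)) ⟩
    ι (+ 2) * (ι (+ 3) + μ) * (ι (+ 2) * μ + 1#) * E (6 ℕ.+ j)
    + ι (+ 2) * (μ + 1#) * (μ - 1#) * (E 1 * E (5 ℕ.+ j))
    - ι (+ 2) * (μ - 1#) * (E 2 * E (4 ℕ.+ j)) + ((K ⊛ H) j + E 2 * H (1 ℕ.+ j))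
      ≈⟨ +-congʳ (+-cong (+-cong
           (*-congʳ (*-cong (*-congˡ (+-congˡ (ι-suc (+ (2 ℕ.+ j))))) (+-congʳ (*-congˡ (ι-suc (+ (2 ℕ.+ j)))))))
           (*-congʳ (*-cong (*-congˡ (+-congʳ (ι-suc (+ (2 ℕ.+ j))))) (+-congʳ (ι-suc (+ (2 ℕ.+ j)))))))
           (-‿cong (*-congʳ (*-congˡ (+-congʳ (ι-suc (+ (2 ℕ.+ j)))))))) ⟩
    ι (+ 2) * (ι (+ 3) + (1# + ν)) * (ι (+ 2) * (1# + ν) + 1#) * E (6 ℕ.+ j)
    + ι (+ 2) * ((1# + ν) + 1#) * ((1# + ν) - 1#) * (E 1 * E (5 ℕ.+ j))
    - ι (+ 2) * ((1# + ν) - 1#) * (E 2 * E (4 ℕ.+ j)) + ((K ⊛ H) j + E 2 * H (1 ℕ.+ j))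
      ≈⟨ solve 8 (λ ν e₁ e₂ e₄ e₅ e₆ k h →
           con (+ 2) :* (con (+ 3) :+ (con (+ 1) :+ ν)) :* (con (+ 2) :* (con (+ 1) :+ ν) :+ con (+ 1)) :* e₆
           :+ con (+ 2) :* ((con (+ 1) :+ ν) :+ con (+ 1)) :* ((con (+ 1) :+ ν) :- con (+ 1)) :* (e₁ :* e₅)
           :- con (+ 2) :* ((con (+ 1) :+ ν) :- con (+ 1)) :* (e₂ :* e₄) :+ (k :+ e₂ :* h)
           := k :+ con (+ 2) :* (con (+ 4) :+ ν) :* (con (+ 3) :+ con (+ 2) :* ν) :* e₆
              :+ con (+ 2) :* (con (+ 2) :+ ν) :* ν :* (e₅ :* e₁)
              :+ e₂ :* (h :- con (+ 2) :* ν :* e₄))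
         refl ν (E 1) (E 2) (E (4 ℕ.+ j)) (E (5 ℕ.+ j)) (E (6 ℕ.+ j)) ((K ⊛ H) j) (H (1 ℕ.+ j)) ⟩
    (K ⊛ H) j
    + ι (+ 2) * (ι (+ 4) + ν) * (ι (+ 3) + ι (+ 2) * ν) * E (6 ℕ.+ j)
    + ι (+ 2) * (ι (+ 2) + ν) * ν * (E (5 ℕ.+ j) * E 1)
    + E 2 * (H (1 ℕ.+ j) - ι (+ 2) * ν * E (4 ℕ.+ j))
      ≈⟨ +-cong (+-cong (+-congˡ (*-congʳ ι-c₁)) (*-congʳ ι-c₂)) (*-congˡ (+-congˡ (-‿cong (*-congʳ (ι-pos-* 2 (2 ℕ.+ j)))))) ⟨
    _ ∎
    where
    μ ν : Carrier
    μ = ι (+ (3 ℕ.+ j))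
    ν = ι (+ (2 ℕ.+ j))

    ι-pos-* : ∀ a b → ι (+ (a ℕ.* b)) ≈ ι (+ a) * ι (+ b)
    ι-pos-* a b = trans (ι-cong (ℤ.pos-* a b)) (ι-* (+ a) (+ b))

    ι-c₁ : ι (+ c₁ j) ≈ ι (+ 2) * (ι (+ 4) + ν) * (ι (+ 3) + ι (+ 2) * ν)
    ι-c₁ = trans (ι-cong (≡.cong +_ (ℕ-c₁ j))) (trans (ι-pos-* (2 ℕ.* (6 ℕ.+ j)) (3 ℕ.+ 2 ℕ.* (2 ℕ.+ j)))
      (*-cong (trans (ι-pos-* 2 (6 ℕ.+ j)) (*-congˡ (ι-+ (+ 4) (+ (2 ℕ.+ j)))))
        (trans (ι-+ (+ 3) (+ (2 ℕ.* (2 ℕ.+ j)))) (+-congˡ (ι-pos-* 2 (2 ℕ.+ j))))))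

    ι-c₂ : ι (+ c₂ j) ≈ ι (+ 2) * (ι (+ 2) + ν) * ν
    ι-c₂ = trans (ι-pos-* (2 ℕ.* (4 ℕ.+ j)) (2 ℕ.+ j))
      (*-congʳ (trans (ι-pos-* 2 (4 ℕ.+ j)) (*-congˡ (ι-+ (+ 2) (+ (2 ℕ.+ j))))))

  curry-scaled : ∀ c (f : Monomial N → ℤ) {x} → curry N f ≈ x → curry N (λ α → c ℤ.* f α) ≈ ι c * x
  curry-scaled c f f≈x = trans (curry-scale N c f) (*-congˡ f≈x)

  curry-multiplied : ∀ (f g : Monomial N → ℤ) {x y} → curry N f ≈ x → curry N g ≈ y → curry N (product f g) ≈ x * y
  curry-multiplied f g f≈x g≈y = trans (curry-product N f g) (*-cong f≈x g≈y)

  curry-added : ∀ (f g : Monomial N → ℤ) {x y} → curry N f ≈ x → curry N g ≈ y → curry N (λ α → f α ℤ.+ g α) ≈ x + y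
  curry-added f g f≈x g≈y = trans (curry-+ N f g) (+-cong f≈x g≈y)

  curry-subtracted : ∀ (f g : Monomial N → ℤ) {x y} → curry N f ≈ x → curry N g ≈ y → curry N (λ α → f α ℤ.- g α) ≈ x - y
  curry-subtracted f g f≈x g≈y = curry-added f (λ α → ℤ.- g α) f≈x (trans (curry-neg N g) (-‿cong g≈y))

  module _ (j : ℕ) where
    open RecurrenceTerms v j

    curry-s₁ : curry N (s₁ N) ≈ (K ⊛ H) j
    curry-s₁ = trans
      (curry-cong N (λ α → ≡.trans
        (≡.cong sumℤ (List.map-upTo (λ i → (+ (2 ℕ.+ i)) ℤ.* product (e (3 ℕ.+ i) N) (XC v ((2 ℕ.+ j) ∸ i) N) α) (suc j)))
        -- For i ≤ j the index `(2 + j) ∸ i` is `2 + (j ∸ i)`, which is the form that `XC≈H`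
        -- accepts; the smallest cycle that occurs is C₂.
        (sumℤ-upTo-cong (suc j) (λ i i<1+j →
          ≡.cong (λ n → (+ (2 ℕ.+ i)) ℤ.* product (e (3 ℕ.+ i) N) (XC v n N) α) (ℕ.+-∸-assoc 2 (ℕ.≤-pred i<1+j))))))
      (curry-convolution N (λ i l α → (+ (2 ℕ.+ i)) ℤ.* product (e (3 ℕ.+ i) N) (XC v (2 ℕ.+ l) N) α) K H
        (λ i l → trans
          (curry-scaled (+ (2 ℕ.+ i)) (product (e (3 ℕ.+ i) N) (XC v (2 ℕ.+ l) N))
            (curry-multiplied (e (3 ℕ.+ i) N) (XC v (2 ℕ.+ l) N) (curry-e N (3 ℕ.+ i)) (XC≈H l)))
          (sym (*-assoc _ _ _)))
        j)

    curry-s₂ : curry N (s₂ N) ≈ ι (+ c₁ j) * E (6 ℕ.+ j)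
    curry-s₂ = curry-scaled (+ c₁ j) (e (5 ℕ.+ j ℕ.+ 1) N)
      (trans (curry-e N (5 ℕ.+ j ℕ.+ 1)) (reflexive (≡.cong E (ℕ.+-comm (5 ℕ.+ j) 1))))

    curry-s₃ : curry N (s₃ N) ≈ ι (+ c₂ j) * (E (5 ℕ.+ j) * E 1)
    curry-s₃ = curry-scaled (+ c₂ j) (product (e (5 ℕ.+ j) N) (e 1 N))
      (curry-multiplied (e (5 ℕ.+ j) N) (e 1 N) (curry-e N (5 ℕ.+ j)) (curry-e N 1))

    curry-s₄ : curry N (s₄ N) ≈ E 2 * (H (1 ℕ.+ j) - ι (+ c₃ j) * E (4 ℕ.+ j))
    curry-s₄ = curry-multiplied (e 2 N) (λ α → XC v (3 ℕ.+ j) N α ℤ.- (+ c₃ j) ℤ.* e (4 ℕ.+ j) N α) (curry-e N 2)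
      (curry-subtracted (XC v (3 ℕ.+ j) N) (λ α → (+ c₃ j) ℤ.* e (4 ℕ.+ j) N α) (XC≈H (1 ℕ.+ j))
        (curry-scaled (+ c₃ j) (e (4 ℕ.+ j) N) (curry-e N (4 ℕ.+ j))))

    curry-rhs : curry N (λ α → s₁ N α ℤ.+ s₂ N α ℤ.+ s₃ N α ℤ.+ s₄ N α) ≈ H (3 ℕ.+ j)
    curry-rhs = trans
      (curry-added (λ α → s₁ N α ℤ.+ s₂ N α ℤ.+ s₃ N α) (s₄ N)
        (curry-added (λ α → s₁ N α ℤ.+ s₂ N α) (s₃ N) (curry-added (s₁ N) (s₂ N) curry-s₁ curry-s₂) curry-s₃) curry-s₄)
      (sym (H-step j))

module _ (v : CycleVertices) where
  open Defs
  open RecurrenceTerms v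

  XC-recurrence : ∀ j → XC v (5 ℕ.+ j) ≈ s₁ j + s₂ j + s₃ j + s₄ j
  XC-recurrence j N = curry-injective N (R.trans N (XC≈H (3 ℕ.+ j)) (R.sym N (curry-rhs j)))
    where open Recurrence v N

  XC-1 : XC v 1 ≈ (+ 2) · e 2
  XC-1 N = curry-injective N (R.trans N XC₁ (R.sym N (curry-scaled (+ 2) (e 2 N) (curry-e N 2))))
    where open Recurrence v N

  XC-2 : XC v 2 ≈ (+ 6) · e 3
  XC-2 N = curry-injective N (R.trans N (XC≈H 0) (R.trans N H-0 (R.sym N (curry-scaled (+ 6) (e 3 N) (curry-e N 3)))))
    where open Recurrence v N

  XC-3 : XC v 3 ≈ (+ 24) · e 4
  XC-3 N = curry-injective N (R.trans N (XC≈H 1) (R.trans N H-1 (R.sym N (curry-scaled (+ 24) (e 4 N) (curry-e N 4)))))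
    where open Recurrence v N

  XC-4 : XC v 4 ≈ (+ 50) · e 5 + (+ 6) · (e 4 * e 1) + (+ 4) · (e 3 * e 2)
  XC-4 N = curry-injective N (R.trans N (XC≈H 2) (R.trans N H-2 (R.sym N
    (curry-added (((+ 50) · e 5 + (+ 6) · (e 4 * e 1)) N) (((+ 4) · (e 3 * e 2)) N)
      (curry-added (((+ 50) · e 5) N) (((+ 6) · (e 4 * e 1)) N)
        (curry-scaled (+ 50) (e 5 N) (curry-e N 5))
        (curry-scaled (+ 6) ((e 4 * e 1) N) (curry-multiplied (e 4 N) (e 1 N) (curry-e N 4) (curry-e N 1))))
      (curry-scaled (+ 4) ((e 3 * e 2) N) (curry-multiplied (e 3 N) (e 2 N) (curry-e N 3) (curry-e N 2)))))))
    where open Recurrence v N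

-- Arithmetic of series and expansions in the e-basis

open import Defs

≈-sym : ∀ {f g} → f ≈ g → g ≈ f
≈-sym p N α = ≡.sym (p N α)

≈-trans : ∀ {f g h} → f ≈ g → g ≈ h → f ≈ h
≈-trans p q N α = ≡.trans (p N α) (q N α)

-- This and the following laws for the product of series are pulled back from the ring along
-- `curry`.
*-congˡ : ∀ f {g h} → g ≈ h → f * g ≈ f * h
*-congˡ f {g} {h} p N = curry-injective N (R.trans N (curry-product N (f N) (g N))
  (R.trans N (R.*-congˡ N (curry-cong N (p N))) (R.sym N (curry-product N (f N) (h N)))))

*-zeroʳ : ∀ f → f * 0# ≈ 0#
*-zeroʳ f N = curry-injective N (R.trans N (curry-product N (f N) (0# N))
  (R.trans N (R.*-congˡ N (curry-0 N)) (R.trans N (R.zeroʳ N _) (R.sym N (curry-0 N)))))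

*-e₀ : ∀ f → f * e 0 ≈ f
*-e₀ f N = curry-injective N (R.trans N (curry-product N (f N) (e 0 N))
  (R.trans N (R.*-congˡ N (R.trans N (curry-e N 0) (GeneratingFunctions.elem-0 ℤ[[ N ]] (vars N)))) (R.*-identityʳ N _)))

*-swap : ∀ f g h → f * (g * h) ≈ g * (f * h)
*-swap f g h N = curry-injective N (begin
  curry N ((f * (g * h)) N)                           ≈⟨ curry-product N (f N) ((g * h) N) ⟩
  R._*_ N (curry N (f N)) (curry N ((g * h) N))       ≈⟨ R.*-congˡ N (curry-product N (g N) (h N)) ⟩
  R._*_ N F (R._*_ N G H)                             ≈⟨ solve 3 (λ x y z → x :* (y :* z) := y :* (x :* z)) (R.refl N) F G H ⟩
  R._*_ N G (R._*_ N F H)                             ≈⟨ R.*-congˡ N (curry-product N (f N) (h N)) ⟨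
  R._*_ N (curry N (g N)) (curry N ((f * h) N))       ≈⟨ curry-product N (g N) ((f * h) N) ⟨
  curry N ((g * (f * h)) N)                           ∎)
  where
  open R.Solver N using (solve; _:*_; _:=_)
  open SetoidReasoning (R.setoid N)
  F = curry N (f N)
  G = curry N (g N)
  H = curry N (h N)

*-linear : ∀ f c g h → f * (c · g + h) ≈ c · (f * g) + f * h
*-linear f c g h N = curry-injective N (begin
  curry N ((f * (c · g + h)) N)
    ≈⟨ curry-product N (f N) ((c · g + h) N) ⟩
  R._*_ N F (curry N ((c · g + h) N))
    ≈⟨ R.*-congˡ N (R.trans N (curry-+ N ((c · g) N) (h N)) (R.+-congʳ N (curry-scale N c (g N)))) ⟩
  R._*_ N F (R._+_ N (R._*_ N (R.ι N c) G) H)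
    ≈⟨ solve 4 (λ c x y z → x :* (c :* y :+ z) := c :* (x :* y) :+ x :* z) (R.refl N) (R.ι N c) F G H ⟩
  R._+_ N (R._*_ N (R.ι N c) (R._*_ N F G)) (R._*_ N F H)
    ≈⟨ R.+-cong N (R.trans N (curry-scale N c ((f * g) N)) (R.*-congˡ N (curry-product N (f N) (g N)))) (curry-product N (f N) (h N)) ⟨
  R._+_ N (curry N ((c · (f * g)) N)) (curry N ((f * h) N))
    ≈⟨ curry-+ N ((c · (f * g)) N) ((f * h) N) ⟨
  curry N ((c · (f * g) + f * h) N)
    ∎)
  where
  open R.Solver N using (solve; _:*_; _:+_; _:=_)
  open SetoidReasoning (R.setoid N)
  F = curry N (f N)
  G = curry N (g N)
  H = curry N (h N)

eProduct-↭ : ∀ {ks ls} → ks ↭ ls → eProduct ks ≈ eProduct ls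
eProduct-↭ ↭.refl        = λ _ _ → ≡.refl
eProduct-↭ (↭.prep k p)  = *-congˡ (e k) (eProduct-↭ p)
eProduct-↭ {ls = _ ∷ _ ∷ ls} (↭.swap k l p) =
  ≈-trans (*-congˡ (e k) (*-congˡ (e l) (eProduct-↭ p))) (*-swap (e k) (e l) (eProduct ls))
eProduct-↭ (↭.trans p q) = ≈-trans (eProduct-↭ p) (eProduct-↭ q)

-- Nonnegative combinations of e-products in which like terms need not be collected.
data EPos (f : Series) : Set where
  none : f ≈ 0# → EPos f
  term : ∀ c ks → All NonZero ks → ∀ {g} → EPos g → f ≈ (+ c) · eProduct ks + g → EPos f

epos-cong : ∀ {f g} → f ≈ g → EPos g → EPos f
epos-cong f≈g (none g≈0)           = none (≈-trans f≈g g≈0)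
epos-cong f≈g (term c ks ks≢0 h g≈) = term c ks ks≢0 h (≈-trans f≈g g≈)

epos-+ : ∀ {f g} → EPos f → EPos g → EPos (f + g)
epos-+ {f} {g} (none f≈0) eg =
  epos-cong (λ N α → ≡.trans (≡.cong (ℤ._+ g N α) (f≈0 N α)) (ℤ.+-identityˡ (g N α))) eg
epos-+ {f} {g} (term c ks ks≢0 {h} eh f≈) eg = term c ks ks≢0 (epos-+ eh eg) (λ N α →
  ≡.trans (≡.cong (ℤ._+ g N α) (f≈ N α)) (ℤ.+-assoc (((+ c) · eProduct ks) N α) (h N α) (g N α)))

epos-· : ∀ n {f} → EPos f → EPos ((+ n) · f)
epos-· n (none f≈0) = none (λ N α → ≡.trans (≡.cong ((+ n) ℤ.*_) (f≈0 N α)) (ℤ.*-zeroʳ (+ n)))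
epos-· n (term c ks ks≢0 {g} eg f≈) = term (n ℕ.* c) ks ks≢0 (epos-· n eg) (λ N α →
  ≡.trans (≡.cong ((+ n) ℤ.*_) (f≈ N α)) (≡.trans (ℤ.*-distribˡ-+ (+ n) ((+ c) ℤ.* eProduct ks N α) (g N α))
    (≡.cong (ℤ._+ (+ n) ℤ.* g N α) (≡.trans (≡.sym (ℤ.*-assoc (+ n) (+ c) (eProduct ks N α)))
      (≡.cong (ℤ._* eProduct ks N α) (≡.sym (ℤ.pos-* n c)))))))

epos-e* : ∀ k {f} → EPos f → EPos (e (suc k) * f)
epos-e* k (none f≈0) = none (≈-trans (*-congˡ (e (suc k)) f≈0) (*-zeroʳ (e (suc k))))
epos-e* k (term c ks ks≢0 {g} eg f≈) = term c (suc k ∷ ks) (_ ∷ ks≢0) (epos-e* k eg)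
  (≈-trans (*-congˡ (e (suc k)) f≈) (*-linear (e (suc k)) (+ c) (eProduct ks) g))

-- A one-part e-product is `e (suc k) * e 0`, so the trivial last factor has to be removed.
epos-e : ∀ k → EPos (e (suc k))
epos-e k = epos-cong (≈-sym (*-e₀ (e (suc k)))) (epos-e* k
  (term 1 [] [] (none (λ _ _ → ≡.refl)) (λ N α → ≡.sym (≡.trans (ℤ.+-identityʳ _) (ℤ.*-identityˡ (e 0 N α))))))

epos-∑ : ∀ n (f : ℕ → Series) → (∀ i → EPos (f i)) → EPos (λ N α → sumℤ (map (λ i → f i N α) (upTo n)))
epos-∑ n f ef = epos-cong (λ N α → ≡.cong sumℤ (List.map-upTo (λ i → f i N α) n)) (go n f ef)
  where
  go : ∀ n (f : ℕ → Series) → (∀ i → EPos (f i)) → EPos (λ N α → sumℤ (applyUpTo (λ i → f i N α) n))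
  go zero    f ef = none (λ _ _ → ≡.refl)
  go (suc n) f ef = epos-+ (ef 0) (go n (f ∘ suc) (ef ∘ suc))

partition : ∀ ks → All NonZero ks → Partition
partition ks ks≢0 = record
  { parts      = sort ≥-order ks
  ; positive   = All-resp-↭ (↭-sym (sort-↭ ≥-order ks)) ks≢0
  ; decreasing = sort-↗ ≥-order ks
  }
  where ≥-order = decTotalOrder ℕ.≤-decTotalOrder

e[partition] : ∀ ks ks≢0 → eProduct ks ≈ e[ partition ks ks≢0 ]
e[partition] ks _ = eProduct-↭ (↭-sym (sort-↭ (decTotalOrder ℕ.≤-decTotalOrder) ks))

Terms : Set
Terms = List (ℤ × Partition)

combination : Terms → Series
combination ts N α = sumℤ (map (λ (c , p) → c ℤ.* e[ p ] N α) ts)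

keys : Terms → List (List ℕ)
keys = map (parts ∘ proj₂)

-- Merges like terms to keep the basis elements distinct. Only the parts are compared, as a
-- `Partition` also carries proofs.
insert : ℤ → Partition → Terms → Terms
insert c p []             = (c , p) ∷ []
insert c p ((d , q) ∷ ts) with List.≡-dec ℕ._≟_ (parts p) (parts q)
... | yes _ = (c ℤ.+ d , q) ∷ ts
... | no  _ = (d , q) ∷ insert c p ts

insert-combination : ∀ c p ts → combination (insert c p ts) ≈ c · e[ p ] + combination ts
insert-combination c p []             N α = ≡.refl
insert-combination c p ((d , q) ∷ ts) N α with List.≡-dec ℕ._≟_ (parts p) (parts q)
... | yes p≡q = begin
  (c ℤ.+ d) ℤ.* e[ q ] N α ℤ.+ s                       ≡⟨ solve 4 (λ c d x s → (c :+ d) :* x :+ s := c :* x :+ (d :* x :+ s)) ≡.refl c d (e[ q ] N α) s ⟩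
  c ℤ.* e[ q ] N α ℤ.+ (d ℤ.* e[ q ] N α ℤ.+ s)        ≡⟨ ≡.cong (λ ks → c ℤ.* eProduct ks N α ℤ.+ (d ℤ.* e[ q ] N α ℤ.+ s)) p≡q ⟨
  c ℤ.* e[ p ] N α ℤ.+ (d ℤ.* e[ q ] N α ℤ.+ s)        ∎
  where
  open ≡.≡-Reasoning
  open ℤ.+-*-Solver
  s = combination ts N α
... | no _ = begin
  d ℤ.* e[ q ] N α ℤ.+ combination (insert c p ts) N α
    ≡⟨ ≡.cong (λ s → d ℤ.* e[ q ] N α ℤ.+ s) (insert-combination c p ts N α) ⟩
  d ℤ.* e[ q ] N α ℤ.+ (c ℤ.* e[ p ] N α ℤ.+ s)
    ≡⟨ solve 3 (λ x y s → x :+ (y :+ s) := y :+ (x :+ s)) ≡.refl (d ℤ.* e[ q ] N α) (c ℤ.* e[ p ] N α) s ⟩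
  c ℤ.* e[ p ] N α ℤ.+ (d ℤ.* e[ q ] N α ℤ.+ s)
    ∎
  where
  open ≡.≡-Reasoning
  open ℤ.+-*-Solver
  s = combination ts N α

insert-keys : ∀ {P : List ℕ → Set} c p ts → P (parts p) → All P (keys ts) → All P (keys (insert c p ts))
insert-keys c p []             Pp []         = Pp ∷ []
insert-keys c p ((d , q) ∷ ts) Pp (Pq ∷ Pts) with List.≡-dec ℕ._≟_ (parts p) (parts q)
... | yes _ = Pq ∷ Pts
... | no  _ = Pq ∷ insert-keys c p ts Pp Pts

insert-unique : ∀ c p ts → Unique (keys ts) → Unique (keys (insert c p ts))
insert-unique c p []             []          = [] ∷ []
insert-unique c p ((d , q) ∷ ts) (q∉ts ∷ u) with List.≡-dec ℕ._≟_ (parts p) (parts q)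
... | yes _   = q∉ts ∷ u
... | no  p≢q = insert-keys c p ts (p≢q ∘ ≡.sym) q∉ts ∷ insert-unique c p ts u

insert-nonneg : ∀ {c} p ts → 0ℤ ℤ.≤ c → All (λ (d , _) → 0ℤ ℤ.≤ d) ts → All (λ (d , _) → 0ℤ ℤ.≤ d) (insert c p ts)
insert-nonneg p []             0≤c []           = 0≤c ∷ []
insert-nonneg p ((d , q) ∷ ts) 0≤c (0≤d ∷ 0≤ts) with List.≡-dec ℕ._≟_ (parts p) (parts q)
... | yes _ = ℤ.+-mono-≤ 0≤c 0≤d ∷ 0≤ts
... | no  _ = 0≤d ∷ insert-nonneg p ts 0≤c 0≤ts

ePositive : ∀ {f} → EPos f → EPositive f
ePositive (none f≈0) = record { terms = [] ; distinct = [] ; expands = f≈0 } , []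
ePositive (term c ks ks≢0 {g} eg f≈) =
  let E , 0≤E = ePositive eg
      p       = partition ks ks≢0
  in record
    { terms    = insert (+ c) p (terms E)
    ; distinct = insert-unique (+ c) p (terms E) (distinct E)
    ; expands  = λ N α → ≡.trans (f≈ N α) (≡.trans
        (≡.cong₂ (λ x y → (+ c) ℤ.* x ℤ.+ y) (e[partition] ks ks≢0 N α) (expands E N α))
        (≡.sym (insert-combination (+ c) p (terms E) N α)))
    } , insert-nonneg p (terms E) (ℤ.+≤+ ℕ.z≤n) 0≤E

-- Induction for e-positivity

module _ (v : CycleVertices) where
  open RecurrenceTerms v

  bracket : ℕ → Series
  bracket j = XC v (3 ℕ.+ j) - (+ c₃ j) · e (4 ℕ.+ j)

  bracket⇒XC : ∀ j → EPos (bracket j) → EPos (XC v (3 ℕ.+ j))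
  bracket⇒XC j b = epos-cong
    (λ N α → solve 2 (λ x y → x := x :- y :+ y) ≡.refl (XC v (3 ℕ.+ j) N α) ((+ c₃ j) ℤ.* e (4 ℕ.+ j) N α))
    (epos-+ b (epos-· (c₃ j) (epos-e (3 ℕ.+ j))))
    where open ℤ.+-*-Solver

  bracket-0 : EPos (bracket 0)
  bracket-0 = epos-cong
    (λ N α → ≡.trans (≡.cong (ℤ._- (+ 4) ℤ.* e 4 N α) (XC-3 v N α))
      (solve 1 (λ x → con (+ 24) :* x :- con (+ 4) :* x := con (+ 20) :* x) ≡.refl (e 4 N α)))
    (epos-· 20 (epos-e 3))
    where open ℤ.+-*-Solver

  bracket-1 : EPos (bracket 1)
  bracket-1 = epos-cong
    (λ N α → ≡.trans (≡.cong (ℤ._- (+ 6) ℤ.* e 5 N α) (XC-4 v N α))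
      (solve 3 (λ x y z → con (+ 50) :* x :+ con (+ 6) :* y :+ con (+ 4) :* z :- con (+ 6) :* x :=
                          con (+ 44) :* x :+ con (+ 6) :* y :+ con (+ 4) :* z)
        ≡.refl (e 5 N α) ((e 4 * e 1) N α) ((e 3 * e 2) N α)))
    (epos-+ (epos-+ (epos-· 44 (epos-e 4)) (epos-· 6 (epos-e* 3 (epos-e 0)))) (epos-· 4 (epos-e* 2 (epos-e 1))))
    where open ℤ.+-*-Solver

  -- Shows that the correction subtracted in the next bracket is covered by the coefficient of
  -- e_(n+1) in the recurrence, with a nonnegative remainder.
  c₁-split : ∀ j → c₁ j ≡ 76 ℕ.+ 36 ℕ.* j ℕ.+ 4 ℕ.* j ℕ.* j ℕ.+ c₃ (2 ℕ.+ j)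
  c₁-split j = ≡.trans (ℕ-c₁ j) (solve 1 (λ j →
    con 2 :* (con 4 :+ (con 2 :+ j)) :* (con 3 :+ con 2 :* (con 2 :+ j)) :=
    con 76 :+ con 36 :* j :+ con 4 :* j :* j :+ con 2 :* (con 2 :+ (con 2 :+ j))) ≡.refl j)
    where open ℕ.+-*-Solver

  epos-s₁-term : ∀ j i → EPos (XC v ((2 ℕ.+ j) ∸ i)) → EPos ((+ (2 ℕ.+ i)) · (e (3 ℕ.+ i) * XC v ((2 ℕ.+ j) ∸ i)))
  epos-s₁-term j i x = epos-· (2 ℕ.+ i) (epos-e* (2 ℕ.+ i) x)

  epos-s₂ : ∀ j → EPos (s₂ j)
  epos-s₂ j = epos-· (c₁ j) (epos-e (4 ℕ.+ j ℕ.+ 1))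

  epos-s₃ : ∀ j → EPos (s₃ j)
  epos-s₃ j = epos-· (c₂ j) (epos-e* (4 ℕ.+ j) (epos-e 0))

  -- After the recurrence is inserted, the subtracted multiple of e_(n+1) only lowers the
  -- coefficient of `s₂`; the factor of e₂ in `s₄` is the bracket two steps earlier.
  bracket-step : ∀ j → (∀ i → EPos (XC v ((2 ℕ.+ j) ∸ i))) → EPos (bracket j) → EPos (bracket (2 ℕ.+ j))
  bracket-step j xs b = epos-cong eq
    (epos-+ (epos-+ (epos-+ (epos-∑ (suc j) _ (λ i → epos-s₁-term j i (xs i))) (epos-· c (epos-e (4 ℕ.+ j ℕ.+ 1)))) (epos-s₃ j))
      (epos-e* 1 b))
    where
    open ℤ.+-*-Solver
    c : ℕ
    c = 76 ℕ.+ 36 ℕ.* j ℕ.+ 4 ℕ.* j ℕ.* j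

    eq : bracket (2 ℕ.+ j) ≈ s₁ j + (+ c) · e (5 ℕ.+ j ℕ.+ 1) + s₃ j + s₄ j
    eq N α = begin
      XC v (5 ℕ.+ j) N α ℤ.- (+ c₃ (2 ℕ.+ j)) ℤ.* e (6 ℕ.+ j) N α
        ≡⟨ ≡.cong₂ (λ x k → x ℤ.- (+ c₃ (2 ℕ.+ j)) ℤ.* e k N α) (XC-recurrence v j N α) (≡.sym (ℕ.+-comm (5 ℕ.+ j) 1)) ⟩
      s₁ j N α ℤ.+ (+ c₁ j) ℤ.* x ℤ.+ s₃ j N α ℤ.+ s₄ j N α ℤ.- (+ c₃ (2 ℕ.+ j)) ℤ.* x
        ≡⟨ ≡.cong (λ d → s₁ j N α ℤ.+ d ℤ.* x ℤ.+ s₃ j N α ℤ.+ s₄ j N α ℤ.- (+ c₃ (2 ℕ.+ j)) ℤ.* x)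
             (≡.trans (≡.cong +_ (c₁-split j)) (ℤ.pos-+ c (c₃ (2 ℕ.+ j)))) ⟩
      s₁ j N α ℤ.+ (+ c ℤ.+ + c₃ (2 ℕ.+ j)) ℤ.* x ℤ.+ s₃ j N α ℤ.+ s₄ j N α ℤ.- (+ c₃ (2 ℕ.+ j)) ℤ.* x
        ≡⟨ solve 6 (λ s c d x t u → s :+ (c :+ d) :* x :+ t :+ u :- d :* x := s :+ c :* x :+ t :+ u) ≡.refl
             (s₁ j N α) (+ c) (+ c₃ (2 ℕ.+ j)) x (s₃ j N α) (s₄ j N α) ⟩
      s₁ j N α ℤ.+ (+ c) ℤ.* x ℤ.+ s₃ j N α ℤ.+ s₄ j N α
        ∎
      where
      open ≡.≡-Reasoning
      x : ℤ
      x = e (5 ℕ.+ j ℕ.+ 1) N α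

  -- The two components are offset: `bracket n` concerns the cycle on n + 3 vertices. The value `0#`
  -- of `XC v 0` lets the induction start at zero.
  XC-bracket-epos : ∀ n → EPos (XC v n) × EPos (bracket n)
  XC-bracket-epos = <-rec _ (λ n rec → xc n rec , br n rec)
    where
    Below : ℕ → Set
    Below n = ∀ {m} → m ℕ.< n → EPos (XC v m) × EPos (bracket m)

    xc : ∀ n → Below n → EPos (XC v n)
    xc 0 rec = none (λ _ _ → ≡.refl)
    xc 1 rec = epos-cong (XC-1 v) (epos-· 2 (epos-e 1))
    xc 2 rec = epos-cong (XC-2 v) (epos-· 6 (epos-e 2))
    xc (suc (suc (suc j))) rec = bracket⇒XC j (proj₂ (rec (ℕ.m<n+m j (ℕ.s≤s ℕ.z≤n))))

    br : ∀ n → Below n → EPos (bracket n)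
    br 0 rec = bracket-0
    br 1 rec = bracket-1
    br (suc (suc j)) rec = bracket-step j
      (λ where
        -- The largest cycle in the sum has the current index, so it comes from `xc` and not from
        -- the induction hypothesis.
        zero    → xc (2 ℕ.+ j) rec
        (suc i) → proj₁ (rec (ℕ.s≤s (ℕ.m∸n≤m (1 ℕ.+ j) i))))
      (proj₂ (rec (ℕ.m<n+m j (ℕ.s≤s ℕ.z≤n))))

theorem4p6 : (v : CycleVertices) →
    (∀ n → 1 ≤ n → EPositive (XC v n))
    × (∀ n → 5 ≤ n →
    (XC v n ≈
    ∑[ 3 ⋯ n ∸ 2 ] (λ k → (+ (k ∸ 1)) · (e k * XC v (n ∸ k)))
    + (+ (2 ℕ.* (n ℕ.+ 1) ℕ.* (2 ℕ.* n ∸ 3))) · e (n ℕ.+ 1)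
    + (+ (2 ℕ.* (n ∸ 1) ℕ.* (n ∸ 3))) · (e n * e 1)
    + e 2 * (XC v (n ∸ 2) - (+ (2 ℕ.* (n ∸ 3))) · e (n ∸ 1)))
    × (∀ k → 3 ≤ k → k ≤ n ∸ 2 → EPositive ((+ (k ∸ 1)) · (e k * XC v (n ∸ k))))
    × EPositive ((+ (2 ℕ.* (n ℕ.+ 1) ℕ.* (2 ℕ.* n ∸ 3))) · e (n ℕ.+ 1))
    × EPositive ((+ (2 ℕ.* (n ∸ 1) ℕ.* (n ∸ 3))) · (e n * e 1))
    × EPositive (e 2 * (XC v (n ∸ 2) - (+ (2 ℕ.* (n ∸ 3))) · e (n ∸ 1)))
    × EPositive (XC v (n ∸ 2) - (+ (2 ℕ.* (n ∸ 3))) · e (n ∸ 1)))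
    × (XC v 1 ≈ (+ 2) · e 2)
    × (XC v 2 ≈ (+ 6) · e 3)
    × (XC v 3 ≈ (+ 24) · e 4)
    × (XC v 4 ≈ (+ 50) · e 5 + (+ 6) · (e 4 * e 1) + (+ 4) · (e 3 * e 2))
theorem4p6 v =
  (λ n _ → ePositive (xc n)) ,
  recurrence ,
  XC-1 v , XC-2 v , XC-3 v , XC-4 v
  where
  xc : ∀ n → EPos (XC v n)
  xc n = proj₁ (XC-bracket-epos v n)

  br : ∀ j → EPos (bracket v j)
  br j = proj₂ (XC-bracket-epos v j)

  recurrence : ∀ n → 5 ≤ n → _
  -- With five successors exposed, the subtractions from `n` in the recurrence reduce, and its terms
  -- become those of `RecurrenceTerms`.
  recurrence (suc (suc (suc (suc (suc j))))) (ℕ.s≤s (ℕ.s≤s (ℕ.s≤s (ℕ.s≤s (ℕ.s≤s _))))) =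
    XC-recurrence v j ,
    (λ where (suc (suc (suc i))) (ℕ.s≤s (ℕ.s≤s (ℕ.s≤s _))) _ → ePositive (epos-s₁-term v j i (xc ((2 ℕ.+ j) ∸ i)))) ,
    ePositive (epos-s₂ v j) ,
    ePositive (epos-s₃ v j) ,
    ePositive (epos-e* 1 (br j)) ,
    ePositive (br j)
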